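{- For every positive integer $n$: - if $n\equiv 1\pmod 4$, then $t(1,3,16;n)=2N(1,3,16;2n+5)=t(2,2,3;(n-1)/4)$; - if $n\equiv 0\pmod 4$, then $t(1,3,48;n)=2N(1,3,48;2n+13)=t(1,6,6;n/4)$; - if $n\equiv 3,5\pmod 8$, then $t(1,3,4;n)=\frac43N(1,3,4;2n+2)$; - if $n\equiv 0,2\pmod 8$, then $t(1,3,12;n)=\frac43N(1,3,12;2n+4)$; - if $n\equiv 1,7\pmod 8$, then $t(1,3,36;n)=\frac43N(1,3,36;2n+10)$; - if $n\equiv 2,4\pmod 8$, then $t(3,4,9;n)=\frac43N(3,4,9;2n+4)$.
   Context: For positive integers $a,b,c$ and $n\in\mathbb{N}=\{0,1,2,\dots\}$, $N(a,b,c;n)$ denotes the number of triples $(x,y,z)\in\mathbb{Z}^3$ with $n=ax^2+by^2+cz^2$, and $t(a,b,c;n)$ denotes the number of triples $(x,y,z)\in\mathbb{Z}^3$ with $n=a\frac{x(x+1)}2+b\frac{y(y+1)}2+c\frac{z(z+1)}2$. -}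

module Defs where

open import Data.Nat using (ℕ; suc; _+_; _*_; _/_)
open import Data.Integer as ℤ using (ℤ; +_; -[1+_]; ∣_∣)
open import Data.List using (List; map; upTo; _++_)
open import Data.Nat.ListAction using (sum)
open import Data.Bool using (if_then_else_)
open import Relation.Nullary.Decidable using (does)
import Data.Nat as ℕ

intsUpTo : ℕ → List ℤ
intsUpTo B = map +_ (upTo (suc B)) ++ map -[1+_] (upTo B)

count3 : ℕ → (ℤ → ℤ → ℤ → ℕ) → ℕ → ℕ
count3 B f n =
  sum (map (λ x → sum (map (λ y → sum (map (λ z →
    if does (f x y z ℕ.≟ n) then 1 else 0) (intsUpTo B))) (intsUpTo B))) (intsUpTo B))

sq : ℤ → ℕ
sq x = ∣ x ℤ.* x ∣

-- triangular value x(x+1)/2 of an integer (x(x+1) ≥ 0 for every integer x)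
tri : ℤ → ℕ
tri x = ∣ x ℤ.* (x ℤ.+ + 1) ∣ / 2

-- N(a,b,c;n) = #{(x,y,z) ∈ ℤ³ : n = a x² + b y² + c z²}.
-- For positive a,b,c every solution has |x|,|y|,|z| ≤ n, so counting over
-- the box [-(n+1), n+1]^3 counts all of ℤ³.
N : ℕ → ℕ → ℕ → ℕ → ℕ
N a b c n = count3 (suc n) (λ x y z → a * sq x + b * sq y + c * sq z) n

-- t(a,b,c;n) = #{(x,y,z) ∈ ℤ³ : n = a x(x+1)/2 + b y(y+1)/2 + c z(z+1)/2}.
-- For positive a,b,c every solution has -(n+1) ≤ x,y,z ≤ n, so the box
-- [-(n+1), n+1]^3 contains all solutions.
t : ℕ → ℕ → ℕ → ℕ → ℕ
t a b c n = count3 (suc n) (λ x y z → a * tri x + b * tri y + c * tri z) n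

{-# OPTIONS --safe #-}
module Submission where

-- With X = 2x + 1 etc., t counts the odd solutions of aX² + bY² + cZ² = 8n + a + b + c.
-- Everything rests on one doubling principle: for odd X, Y exactly one of X ≡ Y, X ≡ -Y
-- (mod 4) holds, and X = Y + 4q gives X² + 3Y² = 4((Y + q)² + 3q²).  Hence X² + 3Y² = 4m has
-- twice as many odd solutions as x² + 3y² = m has solutions with x + y odd; likewise
-- X² + Y² = 2((Y + 2q)² + 4q²) doubles the odd solutions.  In the first two identities both
-- t's are in this way twice the number of solutions counted by N.  In the other four, let C be
-- the solutions of bx² + 3by² + cz² = L, where 2n + b + c = 4L.  The solutions of
-- bx² + 3by² + 4cz² = 4L have x, y both even (one copy of C) or both odd (two copies), so
-- N = 3|C|.  The odd solutions are two copies of A, the solutions of bx² + 3by² + cz² = 4L with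
-- z odd, and there z and whichever of x, y is odd again form a multiple of X² + 3Y², so that
-- A is two copies of C and t = 4|C|.

open import Defs

module TernaryForms where
  open import Data.Bool using (if_then_else_)
  open import Data.Empty using (⊥; ⊥-elim)
  open import Data.Fin using (Fin; zero; suc; toℕ; fromℕ<)
  open import Data.Fin.Permutation using (↔⇒≡)
  open import Data.Fin.Properties using (+↔⊎; all?; toℕ-fromℕ<)
  open import Data.Integer
    using (ℤ; +_; -[1+_]; ∣_∣; _+_; _*_; _-_; -_; 0ℤ; NonZero; _/ℕ_; _%ℕ_)
  open import Data.Integer.DivMod using (a≡a%ℕn+[a/ℕn]*n; n%ℕd<d)
  import Data.Integer.Properties as ℤ
  open import Data.Integer.Tactic.RingSolver using (solve-∀)
  open import Data.List using (List; []; _∷_; map; upTo)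
  open import Data.List.Membership.Propositional using (_∈_)
  open import Data.List.Membership.Propositional.Properties
    using (∈-map⁺; ∈-map⁻; ∈-upTo⁺; ∈-++⁺ˡ; ∈-++⁺ʳ)
  open import Data.List.Membership.Propositional.Properties.WithK using (unique⇒irrelevant)
  open import Data.List.Relation.Unary.Any using (here; there)
  open import Data.List.Relation.Unary.Unique.Propositional using (Unique)
  open import Data.List.Relation.Unary.Unique.Propositional.Properties using (map⁺; ++⁺; upTo⁺)
  open import Data.Nat as ℕ using (ℕ; suc; z≤n; s≤s)
  import Data.Nat.DivMod as ℕ
  open import Data.Nat.ListAction using (sum)
  import Data.Nat.Properties as ℕ
  open import Data.Nat.Tactic.RingSolver using () renaming (solve-∀ to ℕ-solve-∀)
  open import Data.Product using (Σ; _×_; _,_; proj₁; proj₂)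
  open import Data.Sum using (_⊎_; inj₁; inj₂)
  open import Data.Sum.Function.Propositional using (_⊎-↔_)
  open import Function using (_↔_; mk↔ₛ′)
  open import Function.Properties.Inverse using (↔-sym; ↔-trans)
  open import Relation.Binary.PropositionalEquality
  open import Relation.Binary.PropositionalEquality.WithK using (≡-irrelevant)
  open import Relation.Nullary.Decidable
    using (Dec; does; yes; no; True; toWitness; _→-dec_)
  open import Algebra.Properties.AbelianGroup ℤ.+-0-abelianGroup
    using () renaming (∙-cancelʳ to +-cancelʳ)

  infixr 2 _⟫_
  _⟫_ : ∀ {A B C : Set} → A ↔ B → B ↔ C → A ↔ C
  _⟫_ = ↔-trans

  -- Counting by bijections with finite types

  -- The membership proof stays in the type, so that an entry listed several times contributes once
  -- for each occurrence.
  sum-map-↔ : {h : ℤ → ℕ} {P : ℤ → Set} → (∀ x → Fin (h x) ↔ P x) →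
    ∀ L → Fin (sum (map h L)) ↔ Σ ℤ (λ x → x ∈ L × P x)
  sum-map-↔ _ [] = mk↔ₛ′ (λ ()) (λ { (_ , () , _) }) (λ { (_ , () , _) }) (λ ())
  sum-map-↔ {h} {P} h↔P (x ∷ L) =
    +↔⊎ {h x} ⟫ (h↔P x ⊎-↔ sum-map-↔ h↔P L) ⟫ mk↔ₛ′
      (λ { (inj₁ p) → x , here refl , p ; (inj₂ (y , y∈L , p)) → y , there y∈L , p })
      (λ { (_ , here refl , p) → inj₁ p ; (y , there y∈L , p) → inj₂ (y , y∈L , p) })
      (λ { (_ , here refl , _) → refl ; (_ , there _ , _) → refl })
      (λ { (inj₁ _) → refl ; (inj₂ _) → refl })

  sum-unique-↔ : {h : ℤ → ℕ} {P : ℤ → Set} {L : List ℤ} → Unique L →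
    (∀ x → Fin (h x) ↔ P x) → (∀ x → P x → x ∈ L) → Fin (sum (map h L)) ↔ Σ ℤ P
  sum-unique-↔ {L = L} unique h↔P P⊆L = sum-map-↔ h↔P L ⟫ mk↔ₛ′
    (λ (x , _ , p) → x , p)
    (λ (x , p) → x , P⊆L x p , p)
    (λ _ → refl)
    (λ (x , x∈L , p) → cong (λ m → x , m , p) (unique⇒irrelevant unique _ _))

  intsUpTo-unique : ∀ B → Unique (intsUpTo B)
  intsUpTo-unique B = ++⁺ (map⁺ ℤ.+-injective (upTo⁺ (suc B)))
    (map⁺ ℤ.-[1+-injective (upTo⁺ B)) disjoint
    where
    disjoint : ∀ {x} → x ∈ map +_ (upTo (suc B)) × x ∈ map -[1+_] (upTo B) → ⊥
    disjoint (p , q) with ∈-map⁻ +_ p | ∈-map⁻ -[1+_] q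
    ... | _ , _ , refl | _ , _ , ()

  ∣∣≤⇒∈intsUpTo : ∀ {B} x → ∣ x ∣ ℕ.≤ B → x ∈ intsUpTo B
  ∣∣≤⇒∈intsUpTo (+ k) k≤B = ∈-++⁺ˡ (∈-map⁺ +_ (∈-upTo⁺ (s≤s k≤B)))
  ∣∣≤⇒∈intsUpTo {B} -[1+ k ] k<B = ∈-++⁺ʳ (map +_ (upTo (suc B))) (∈-map⁺ -[1+_] (∈-upTo⁺ k<B))

  indicator-↔ : ∀ {m n : ℕ} (m≟n : Dec (m ≡ n)) → Fin (if does m≟n then 1 else 0) ↔ m ≡ n
  indicator-↔ (yes m≡n) = mk↔ₛ′ (λ _ → m≡n) (λ _ → zero) (λ _ → ≡-irrelevant _ _) (λ { zero → refl ; (suc ()) })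
  indicator-↔ (no  m≢n) = mk↔ₛ′ (λ ()) (λ e → ⊥-elim (m≢n e)) (λ e → ⊥-elim (m≢n e)) (λ ())

  -- The coordinates are unbounded and the equation is the vanishing of one function, so that a
  -- change of variables is a composition with `F`.
  record Sol (F : ℤ → ℤ → ℤ → ℤ) : Set where
    constructor sol
    field
      x y z : ℤ
      root : F x y z ≡ 0ℤ

  Sol-≡ : ∀ {F x x′ y y′ z z′} {e : F x y z ≡ 0ℤ} {e′ : F x′ y′ z′ ≡ 0ℤ} →
    x ≡ x′ → y ≡ y′ → z ≡ z′ → sol {F} x y z e ≡ sol x′ y′ z′ e′
  Sol-≡ refl refl refl = cong (sol _ _ _) (≡-irrelevant _ _)

  *-cancel-0 : ∀ k {i} .{{_ : NonZero k}} → k * i ≡ 0ℤ → i ≡ 0ℤ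
  *-cancel-0 k {i} e = ℤ.*-cancelˡ-≡ k i 0ℤ (trans e (sym (ℤ.*-zeroʳ k)))

  -- The box loses no solution, since `bound` places every one inside it. The factor `k` is 1 for
  -- `N` and 8 for `t`, where completing the squares multiplies the equation by 8.
  count3-↔ : ∀ {B n} f {F : ℤ → ℤ → ℤ → ℤ} (k : ℤ) .{{_ : NonZero k}} →
    (∀ x y z → f x y z ≡ n → ∣ x ∣ ℕ.≤ B × ∣ y ∣ ℕ.≤ B × ∣ z ∣ ℕ.≤ B) →
    (∀ x y z → F x y z ≡ k * (+ f x y z - + n)) →
    Fin (count3 B f n) ↔ Sol F
  count3-↔ {B} {n} f {F} k bound F≡ =
    sum-unique-↔ U
      (λ x → sum-unique-↔ U
        (λ y → sum-unique-↔ U (λ z → indicator-↔ (f x y z ℕ.≟ n))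
          (λ z e → ∣∣≤⇒∈intsUpTo z (proj₂ (proj₂ (bound x y z e)))))
        (λ { y (z , e) → ∣∣≤⇒∈intsUpTo y (proj₁ (proj₂ (bound x y z e))) }))
      (λ { x (y , z , e) → ∣∣≤⇒∈intsUpTo x (proj₁ (bound x y z e)) })
    ⟫ mk↔ₛ′ (λ (x , y , z , e) → sol x y z (to e))
             (λ (sol x y z e) → x , y , z , from e)
             (λ (sol x y z _) → cong (sol x y z) (≡-irrelevant _ _))
             (λ (x , y , z , _) → cong (λ e → x , y , z , e) (≡-irrelevant _ _))
    where
    U = intsUpTo-unique B

    to : ∀ {x y z} → f x y z ≡ n → F x y z ≡ 0ℤ
    to {x} {y} {z} e = begin
      F x y z                   ≡⟨ F≡ x y z ⟩
      k * (+ f x y z - + n)     ≡⟨ cong (λ m → k * (+ m - + n)) e ⟩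
      k * (+ n - + n)           ≡⟨ cong (k *_) (ℤ.+-inverseʳ (+ n)) ⟩
      k * 0ℤ                    ≡⟨ ℤ.*-zeroʳ k ⟩
      0ℤ                        ∎
      where open ≡-Reasoning

    from : ∀ {x y z} → F x y z ≡ 0ℤ → f x y z ≡ n
    from {x} {y} {z} e = ℤ.+-injective (ℤ.i-j≡0⇒i≡j (+ f x y z) (+ n)
      (*-cancel-0 k (trans (sym (F≡ x y z)) e)))

  -- Bounds and identities for squares and triangular values

  weighted-bound : ∀ a b c {n} {{_ : ℕ.NonZero a}} {{_ : ℕ.NonZero b}} {{_ : ℕ.NonZero c}}
    (s : ℤ → ℕ) → (∀ x → ∣ x ∣ ℕ.≤ suc (s x)) →
    ∀ x y z → a ℕ.* s x ℕ.+ b ℕ.* s y ℕ.+ c ℕ.* s z ≡ n →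
    ∣ x ∣ ℕ.≤ suc n × ∣ y ∣ ℕ.≤ suc n × ∣ z ∣ ℕ.≤ suc n
  weighted-bound a b c s ∣∣≤ x y z refl =
    bound x a (ℕ.≤-trans (ℕ.m≤m+n _ _) (ℕ.m≤m+n _ _)) ,
    bound y b (ℕ.≤-trans (ℕ.m≤n+m (b ℕ.* s y) (a ℕ.* s x)) (ℕ.m≤m+n _ _)) ,
    bound z c (ℕ.m≤n+m _ _)
    where
    bound : ∀ w d {m} {{_ : ℕ.NonZero d}} → d ℕ.* s w ℕ.≤ m → ∣ w ∣ ℕ.≤ suc m
    bound w d d*s≤m = ℕ.≤-trans (∣∣≤ w) (s≤s (ℕ.≤-trans (ℕ.m≤n*m (s w) d) d*s≤m))

  weighted-cong : ∀ a b c {i i′ j j′ k k′ : ℤ} → i ≡ i′ → j ≡ j′ → k ≡ k′ →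
    a * i + b * j + c * k ≡ a * i′ + b * j′ + c * k′
  weighted-cong a b c i≡ j≡ k≡ =
    cong₂ _+_ (cong₂ _+_ (cong (a *_) i≡) (cong (b *_) j≡)) (cong (c *_) k≡)

  pos-weighted : ∀ a b c p q r →
    + (a ℕ.* p ℕ.+ b ℕ.* q ℕ.+ c ℕ.* r) ≡ + a * + p + + b * + q + + c * + r
  pos-weighted a b c p q r = cong₂ _+_ (cong₂ _+_ (ℤ.pos-* a p) (ℤ.pos-* b q)) (ℤ.pos-* c r)

  pos-sq : ∀ x → + sq x ≡ x * x
  pos-sq (+ m)    = trans (cong (λ i → + ∣ i ∣) (sym (ℤ.pos-* m m))) (ℤ.pos-* m m)
  pos-sq -[1+ m ] = refl

  ∣∣≤suc-sq : ∀ x → ∣ x ∣ ℕ.≤ suc (sq x)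
  ∣∣≤suc-sq x rewrite ℤ.abs-* x x with ∣ x ∣
  ... | ℕ.zero = z≤n
  ... | suc m  = ℕ.m≤n⇒m≤1+n (ℕ.m≤m*n (suc m) (suc m))

  -- A recursive form of m(m + 1)/2, free of the division in `tri`.
  triangle : ℕ → ℕ
  triangle ℕ.zero  = 0
  triangle (suc m) = triangle m ℕ.+ suc m

  m*[1+m]≡triangle*2 : ∀ m → m ℕ.* suc m ≡ triangle m ℕ.* 2
  m*[1+m]≡triangle*2 ℕ.zero  = refl
  m*[1+m]≡triangle*2 (suc m) = begin
    suc m ℕ.* suc (suc m)               ≡⟨ step m ⟩
    m ℕ.* suc m ℕ.+ suc m ℕ.* 2         ≡⟨ cong (ℕ._+ suc m ℕ.* 2) (m*[1+m]≡triangle*2 m) ⟩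
    triangle m ℕ.* 2 ℕ.+ suc m ℕ.* 2    ≡⟨ ℕ.*-distribʳ-+ 2 (triangle m) (suc m) ⟨
    triangle (suc m) ℕ.* 2              ∎
    where
    open ≡-Reasoning
    step : ∀ m → suc m ℕ.* suc (suc m) ≡ m ℕ.* suc m ℕ.+ suc m ℕ.* 2
    step = ℕ-solve-∀

  m≤triangle : ∀ m → m ℕ.≤ triangle m
  m≤triangle ℕ.zero  = z≤n
  m≤triangle (suc m) = ℕ.m≤n+m (suc m) (triangle m)

  tri-+ : ∀ m → tri (+ m) ≡ triangle m
  tri-+ m = begin
    ∣ + m * (+ m + + 1) ∣ ℕ./ 2     ≡⟨ cong (ℕ._/ 2) (ℤ.abs-* (+ m) (+ m + + 1)) ⟩
    m ℕ.* (m ℕ.+ 1) ℕ./ 2           ≡⟨ cong (λ p → m ℕ.* p ℕ./ 2) (ℕ.+-comm m 1) ⟩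
    m ℕ.* suc m ℕ./ 2               ≡⟨ cong (ℕ._/ 2) (m*[1+m]≡triangle*2 m) ⟩
    triangle m ℕ.* 2 ℕ./ 2          ≡⟨ ℕ.m*n/n≡m (triangle m) 2 ⟩
    triangle m                      ∎
    where open ≡-Reasoning

  tri-- : ∀ m → tri -[1+ m ] ≡ triangle m
  tri-- m = begin
    ∣ -[1+ m ] * (-[1+ m ] + + 1) ∣ ℕ./ 2   ≡⟨ cong (λ i → ∣ i ∣ ℕ./ 2) (-[1+m]*-m≡ m) ⟩
    ∣ + m * + suc m ∣ ℕ./ 2                 ≡⟨ cong (ℕ._/ 2) (ℤ.abs-* (+ m) (+ suc m)) ⟩
    m ℕ.* suc m ℕ./ 2                       ≡⟨ cong (ℕ._/ 2) (m*[1+m]≡triangle*2 m) ⟩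
    triangle m ℕ.* 2 ℕ./ 2                  ≡⟨ ℕ.m*n/n≡m (triangle m) 2 ⟩
    triangle m                              ∎
    where
    open ≡-Reasoning
    identity : ∀ i → - (+ 1 + i) * (- (+ 1 + i) + + 1) ≡ i * (+ 1 + i)
    identity = solve-∀
    -[1+m]*-m≡ : ∀ m → -[1+ m ] * (-[1+ m ] + + 1) ≡ + m * + suc m
    -[1+m]*-m≡ m = identity (+ m)

  [2m+1]²≡8*triangle+1 : ∀ m →
    (+ 2 * + m + + 1) * (+ 2 * + m + + 1) ≡ + 8 * + triangle m + + 1
  [2m+1]²≡8*triangle+1 m = begin
    (+ 2 * + m + + 1) * (+ 2 * + m + + 1)  ≡⟨ expand (+ m) ⟩
    + 4 * (+ m * (+ 1 + + m)) + + 1        ≡⟨ cong (λ i → + 4 * i + + 1) pronic ⟩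
    + 4 * (+ triangle m * + 2) + + 1       ≡⟨ collect (+ triangle m) ⟩
    + 8 * + triangle m + + 1               ∎
    where
    open ≡-Reasoning
    pronic : + m * (+ 1 + + m) ≡ + triangle m * + 2
    pronic = trans (sym (ℤ.pos-* m (suc m)))
      (trans (cong +_ (m*[1+m]≡triangle*2 m)) (ℤ.pos-* (triangle m) 2))
    expand : ∀ i → (+ 2 * i + + 1) * (+ 2 * i + + 1) ≡ + 4 * (i * (+ 1 + i)) + + 1
    expand = solve-∀
    collect : ∀ i → + 4 * (i * + 2) + + 1 ≡ + 8 * i + + 1
    collect = solve-∀

  -- Completing the square turns triangular values into odd squares. A negative x = -(1 + m) is
  -- reflected to m, which only changes the sign of 2x + 1.
  [2x+1]²≡8*tri+1 : ∀ x → (+ 2 * x + + 1) * (+ 2 * x + + 1) ≡ + 8 * + tri x + + 1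
  [2x+1]²≡8*tri+1 (+ m) rewrite tri-+ m = [2m+1]²≡8*triangle+1 m
  [2x+1]²≡8*tri+1 -[1+ m ] rewrite tri-- m =
    trans (reflect (+ m)) ([2m+1]²≡8*triangle+1 m)
    where
    reflect : ∀ i → (+ 2 * - (+ 1 + i) + + 1) * (+ 2 * - (+ 1 + i) + + 1)
      ≡ (+ 2 * i + + 1) * (+ 2 * i + + 1)
    reflect = solve-∀

  -- The successor is forced by x = -1, where `tri` vanishes.
  ∣∣≤suc-tri : ∀ x → ∣ x ∣ ℕ.≤ suc (tri x)
  ∣∣≤suc-tri (+ m) rewrite tri-+ m = ℕ.m≤n⇒m≤1+n (m≤triangle m)
  ∣∣≤suc-tri -[1+ m ] rewrite tri-- m = s≤s (m≤triangle m)

  -- The counts as sizes of solution sets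

  -- The target `m` is separate from `+ n`, so that each use can write it in the shape that its
  -- congruences require.
  N-↔ : ∀ a b c n {m} {{_ : ℕ.NonZero a}} {{_ : ℕ.NonZero b}} {{_ : ℕ.NonZero c}} → + n ≡ m →
    Fin (N a b c n) ↔ Sol (λ x y z → + a * (x * x) + + b * (y * y) + + c * (z * z) - m)
  N-↔ a b c n refl = count3-↔ {suc n} {n} (λ x y z → a ℕ.* sq x ℕ.+ b ℕ.* sq y ℕ.+ c ℕ.* sq z)
    (+ 1) (weighted-bound a b c sq ∣∣≤suc-sq) eq
    where
    eq : ∀ x y z → + a * (x * x) + + b * (y * y) + + c * (z * z) - + n
      ≡ + 1 * (+ (a ℕ.* sq x ℕ.+ b ℕ.* sq y ℕ.+ c ℕ.* sq z) - + n)
    eq x y z = begin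
      + a * (x * x) + + b * (y * y) + + c * (z * z) - + n
        ≡⟨ cong (_- + n) (weighted-cong (+ a) (+ b) (+ c) (pos-sq x) (pos-sq y) (pos-sq z)) ⟨
      + a * + sq x + + b * + sq y + + c * + sq z - + n
        ≡⟨ cong (_- + n) (pos-weighted a b c (sq x) (sq y) (sq z)) ⟨
      + (a ℕ.* sq x ℕ.+ b ℕ.* sq y ℕ.+ c ℕ.* sq z) - + n
        ≡⟨ ℤ.*-identityˡ _ ⟨
      + 1 * (+ (a ℕ.* sq x ℕ.+ b ℕ.* sq y ℕ.+ c ℕ.* sq z) - + n) ∎
      where open ≡-Reasoning

  t-↔ : ∀ a b c n {m} {{_ : ℕ.NonZero a}} {{_ : ℕ.NonZero b}} {{_ : ℕ.NonZero c}} →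
    + 8 * + n + + a + + b + + c ≡ m →
    Fin (t a b c n) ↔ Sol (λ x y z →
      + a * ((+ 2 * x + + 1) * (+ 2 * x + + 1)) + + b * ((+ 2 * y + + 1) * (+ 2 * y + + 1))
      + + c * ((+ 2 * z + + 1) * (+ 2 * z + + 1)) - m)
  t-↔ a b c n refl = count3-↔ {suc n} {n} (λ x y z → a ℕ.* tri x ℕ.+ b ℕ.* tri y ℕ.+ c ℕ.* tri z)
    (+ 8) (weighted-bound a b c tri ∣∣≤suc-tri) eq
    where
    identity : ∀ a b c p q r m →
      a * (+ 8 * p + + 1) + b * (+ 8 * q + + 1) + c * (+ 8 * r + + 1) - (+ 8 * m + a + b + c)
      ≡ + 8 * (a * p + b * q + c * r - m)
    identity = solve-∀
    eq : ∀ x y z →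
      + a * ((+ 2 * x + + 1) * (+ 2 * x + + 1)) + + b * ((+ 2 * y + + 1) * (+ 2 * y + + 1))
      + + c * ((+ 2 * z + + 1) * (+ 2 * z + + 1)) - (+ 8 * + n + + a + + b + + c)
      ≡ + 8 * (+ (a ℕ.* tri x ℕ.+ b ℕ.* tri y ℕ.+ c ℕ.* tri z) - + n)
    eq x y z = begin
      + a * ((+ 2 * x + + 1) * (+ 2 * x + + 1)) + + b * ((+ 2 * y + + 1) * (+ 2 * y + + 1))
      + + c * ((+ 2 * z + + 1) * (+ 2 * z + + 1)) - m
        ≡⟨ cong (_- m) (weighted-cong (+ a) (+ b) (+ c)
             ([2x+1]²≡8*tri+1 x) ([2x+1]²≡8*tri+1 y) ([2x+1]²≡8*tri+1 z)) ⟩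
      + a * (+ 8 * + tri x + + 1) + + b * (+ 8 * + tri y + + 1) + + c * (+ 8 * + tri z + + 1) - m
        ≡⟨ identity (+ a) (+ b) (+ c) (+ tri x) (+ tri y) (+ tri z) (+ n) ⟩
      + 8 * (+ a * + tri x + + b * + tri y + + c * + tri z - + n)
        ≡⟨ cong (λ i → + 8 * (i - + n)) (pos-weighted a b c (tri x) (tri y) (tri z)) ⟨
      + 8 * (+ (a ℕ.* tri x ℕ.+ b ℕ.* tri y ℕ.+ c ℕ.* tri z) - + n) ∎
      where
      open ≡-Reasoning
      m = + 8 * + n + + a + + b + + c

  -- Changes of variables

  bijection : ∀ {A B : Set} (f : A → B) → (∀ {a a′} → f a ≡ f a′ → a ≡ a′) →
    (∀ b → Σ A (λ a → f a ≡ b)) → A ↔ B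
  bijection f inj surj = mk↔ₛ′ f (λ b → proj₁ (surj b)) (λ b → proj₂ (surj b))
    (λ a → inj (proj₂ (surj (f a))))

  Sol-scale : ∀ {F G} k .{{_ : NonZero k}} → (∀ x y z → F x y z ≡ k * G x y z) → Sol F ↔ Sol G
  Sol-scale {F} {G} k F≡kG = mk↔ₛ′
    (λ (sol x y z e) → sol x y z (*-cancel-0 k (trans (sym (F≡kG x y z)) e)))
    (λ (sol x y z e) → sol x y z (trans (F≡kG x y z) (trans (cong (k *_) e) (ℤ.*-zeroʳ k))))
    (λ _ → Sol-≡ refl refl refl)
    (λ _ → Sol-≡ refl refl refl)

  Sol-cong : ∀ {F G} → (∀ x y z → F x y z ≡ G x y z) → Sol F ↔ Sol G
  Sol-cong F≡G = Sol-scale (+ 1) (λ x y z → trans (F≡G x y z) (sym (ℤ.*-identityˡ _)))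

  swap₁₂ : ∀ {F} → Sol F ↔ Sol (λ x y z → F y x z)
  swap₁₂ = mk↔ₛ′ (λ (sol x y z e) → sol y x z e) (λ (sol x y z e) → sol y x z e)
    (λ _ → refl) (λ _ → refl)

  swap₂₃ : ∀ {F} → Sol F ↔ Sol (λ x y z → F x z y)
  swap₂₃ = mk↔ₛ′ (λ (sol x y z e) → sol x z y e) (λ (sol x y z e) → sol x z y e)
    (λ _ → refl) (λ _ → refl)

  -- Here `φ₁` and `φ₂` give the old coordinates in terms of the new ones, and `ψ₁` and `ψ₂` the new
  -- in terms of the old.
  substitute : ∀ {F} (φ₁ φ₂ ψ₁ ψ₂ : ℤ → ℤ → ℤ) →
    (∀ x y → φ₁ (ψ₁ x y) (ψ₂ x y) ≡ x) → (∀ x y → φ₂ (ψ₁ x y) (ψ₂ x y) ≡ y) →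
    (∀ u v → ψ₁ (φ₁ u v) (φ₂ u v) ≡ u) → (∀ u v → ψ₂ (φ₁ u v) (φ₂ u v) ≡ v) →
    Sol F ↔ Sol (λ u v z → F (φ₁ u v) (φ₂ u v) z)
  substitute {F} φ₁ φ₂ ψ₁ ψ₂ φψ₁ φψ₂ ψφ₁ ψφ₂ = mk↔ₛ′
    (λ (sol x y z e) → sol (ψ₁ x y) (ψ₂ x y) z
      (trans (cong₂ (λ x y → F x y z) (φψ₁ x y) (φψ₂ x y)) e))
    (λ (sol u v z e) → sol (φ₁ u v) (φ₂ u v) z e)
    (λ (sol u v z e) → Sol-≡ (ψφ₁ u v) (ψφ₂ u v) refl)
    (λ (sol x y z e) → Sol-≡ (φψ₁ x y) (φψ₂ x y) refl)

  -- The difference x - y becomes a coordinate, so that its parity can be treated like that of a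
  -- variable.
  shear : ∀ {F} → Sol F ↔ Sol (λ d y z → F (d + y) y z)
  shear = substitute (λ d y → d + y) (λ d y → y) (λ x y → x - y) (λ x y → y)
    [x-y]+y≡x (λ _ _ → refl) [x+y]-y≡x (λ _ _ → refl)
    where
    [x-y]+y≡x : ∀ x y → x - y + y ≡ x
    [x-y]+y≡x = solve-∀
    [x+y]-y≡x : ∀ x y → x + y - y ≡ x
    [x+y]-y≡x = solve-∀

  -- Residue classes and rescaled coordinates

  Class : ℤ → ℤ → ℤ → Set
  Class m r x = Σ ℤ (λ u → x ≡ m * u + r)

  rescale-injective : ∀ m r {u u′} .{{_ : NonZero m}} → m * u + r ≡ m * u′ + r → u ≡ u′
  rescale-injective m r e = ℤ.*-cancelˡ-≡ m _ _ (+-cancelʳ r _ _ e)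

  -- The substitution x = mu + r is injective for m ≠ 0, and `class` says that it reaches every
  -- root.
  rescale₁ : ∀ {F} m r .{{_ : NonZero m}} → (∀ x y z → F x y z ≡ 0ℤ → Class m r x) →
    Sol F ↔ Sol (λ u y z → F (m * u + r) y z)
  rescale₁ {F} m r class = ↔-sym (bijection (λ (sol u y z e) → sol (m * u + r) y z e)
    (λ e → Sol-≡ (rescale-injective m r (cong Sol.x e)) (cong Sol.y e) (cong Sol.z e))
    surj)
    where
    surj : ∀ (s : Sol F) → Σ (Sol (λ u y z → F (m * u + r) y z))
      (λ (sol u y z e) → sol (m * u + r) y z e ≡ s)
    surj (sol x y z e) with class x y z e
    ... | u , refl = sol u y z e , refl

  rescale₂ : ∀ {F} m r .{{_ : NonZero m}} → (∀ x y z → F x y z ≡ 0ℤ → Class m r y) →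
    Sol F ↔ Sol (λ x v z → F x (m * v + r) z)
  rescale₂ m r class = swap₁₂ ⟫ rescale₁ m r (λ y x z → class x y z) ⟫ swap₁₂

  -- The quotient `K` is an integer. If it is negative, its multiple of `d` is moved to the other
  -- side, where the rule for remainders of natural numbers applies.
  +≡*+⇒%≡ : ∀ d .{{_ : ℕ.NonZero d}} K {m r} → + m ≡ + d * K + + r → m ℕ.% d ≡ r ℕ.% d
  +≡*+⇒%≡ d (+ k) {m} {r} e = begin
    m ℕ.% d                   ≡⟨ cong (ℕ._% d) (ℤ.+-injective (trans e (cong (_+ + r) (sym (ℤ.pos-* d k))))) ⟩
    (d ℕ.* k ℕ.+ r) ℕ.% d     ≡⟨ cong (ℕ._% d) (trans (ℕ.+-comm (d ℕ.* k) r) (cong (r ℕ.+_) (ℕ.*-comm d k))) ⟩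
    (r ℕ.+ k ℕ.* d) ℕ.% d     ≡⟨ ℕ.[m+kn]%n≡m%n r k d ⟩
    r ℕ.% d                   ∎
    where open ≡-Reasoning
  +≡*+⇒%≡ d K@(-[1+ k ]) {m} {r} e = begin
    m ℕ.% d                       ≡⟨ ℕ.[m+kn]%n≡m%n m (suc k) d ⟨
    (m ℕ.+ suc k ℕ.* d) ℕ.% d     ≡⟨ cong (ℕ._% d) (ℤ.+-injective m+≡r) ⟩
    r ℕ.% d                       ∎
    where
    open ≡-Reasoning
    cancel : ∀ d k r → d * - k + r + k * d ≡ r
    cancel = solve-∀
    m+≡r : + m + + (suc k ℕ.* d) ≡ + r
    m+≡r = trans (cong₂ _+_ e (ℤ.pos-* (suc k) d)) (cancel (+ d) (+ suc k) (+ r))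

  -- A value in `Fin 4` allows statements about residues to be decided by running through all cases.
  residue : ℤ → Fin 4
  residue x = fromℕ< (n%ℕd<d x 4)

  residue-class : ∀ x → x ≡ + 4 * (x /ℕ 4) + + toℕ (residue x)
  residue-class x = begin
    x                                     ≡⟨ a≡a%ℕn+[a/ℕn]*n x 4 ⟩
    + (x %ℕ 4) + (x /ℕ 4) * + 4           ≡⟨ flip (+ (x %ℕ 4)) (x /ℕ 4) ⟩
    + 4 * (x /ℕ 4) + + (x %ℕ 4)           ≡⟨ cong (λ r → + 4 * (x /ℕ 4) + + r) (toℕ-fromℕ< (n%ℕd<d x 4)) ⟨
    + 4 * (x /ℕ 4) + + toℕ (residue x)    ∎
    where
    open ≡-Reasoning
    flip : ∀ r q → r + q * + 4 ≡ + 4 * q + r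
    flip = solve-∀

  class₄ : ∀ x r → toℕ (residue x) ≡ r → Class (+ 4) (+ r) x
  class₄ x r refl = x /ℕ 4 , residue-class x

  -- The remainder `i` may exceed 3, as i + 3j does in `difference-class`; since 4 is even, its
  -- parity is still that of `x`.
  class₂ : ∀ x q i {p} → x ≡ + 4 * q + + i → i ℕ.% 2 ≡ p → Class (+ 2) (+ p) x
  class₂ x q i refl refl = + 2 * q + + (i ℕ./ 2) ,
    trans (cong (λ j → + 4 * q + j) i≡) (regroup q (+ (i ℕ./ 2)) (+ (i ℕ.% 2)))
    where
    i≡ : + i ≡ + (i ℕ.% 2) + + (i ℕ./ 2) * + 2
    i≡ = trans (cong +_ (ℕ.m≡m%n+[m/n]*n i 2)) (cong (λ j → + (i ℕ.% 2) + j) (ℤ.pos-* (i ℕ./ 2) 2))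
    regroup : ∀ q h p → + 4 * q + (p + h * + 2) ≡ + 2 * (+ 2 * q + h) + p
    regroup = solve-∀

  parity-class : ∀ x {p} → toℕ (residue x) ℕ.% 2 ≡ p → Class (+ 2) (+ p) x
  parity-class x = class₂ x (x /ℕ 4) (toℕ (residue x)) (residue-class x)

  difference-class : ∀ x y {p} → (toℕ (residue x) ℕ.+ 3 ℕ.* toℕ (residue y)) ℕ.% 2 ≡ p →
    Class (+ 2) (+ p) (x - y)
  difference-class x y =
    -- The remainder i - j could be negative; taking j off the quotient replaces it by i + 3j.
    class₂ (x - y) (x /ℕ 4 - y /ℕ 4 - + j) (i ℕ.+ 3 ℕ.* j) (begin
      x - y                                                       ≡⟨ cong₂ _-_ (residue-class x) (residue-class y) ⟩
      (+ 4 * (x /ℕ 4) + + i) - (+ 4 * (y /ℕ 4) + + j)             ≡⟨ regroup (x /ℕ 4) (y /ℕ 4) (+ i) (+ j) ⟩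
      + 4 * (x /ℕ 4 - y /ℕ 4 - + j) + (+ i + + 3 * + j)           ≡⟨ cong (λ m → + 4 * (x /ℕ 4 - y /ℕ 4 - + j) + (+ i + m)) (ℤ.pos-* 3 j) ⟨
      + 4 * (x /ℕ 4 - y /ℕ 4 - + j) + + (i ℕ.+ 3 ℕ.* j)           ∎)
    where
    open ≡-Reasoning
    i = toℕ (residue x)
    j = toℕ (residue y)
    regroup : ∀ q q′ i j → (+ 4 * q + i) - (+ 4 * q′ + j) ≡ + 4 * (q - q′ - j) + (i + + 3 * j)
    regroup = solve-∀

  -- The residue sieve

  Quadratic : ℕ → ℕ → ℕ → ℤ → ℤ → ℤ → ℤ → ℤ
  Quadratic a b c m x y z = + a * (x * x) + + b * (y * y) + + c * (z * z) - m

  -- A residue modulo 4 determines the square modulo 8, hence modulo every divisor d of 8.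
  module _ (d e : ℕ) .{{_ : ℕ.NonZero d}} (8≡d*e : + 8 ≡ + d * + e) (a b c r : ℕ) where

    reduce : ∀ M x y z → Quadratic a b c (+ d * M + + r) x y z ≡ 0ℤ →
      let i = toℕ (residue x); j = toℕ (residue y); k = toℕ (residue z) in
      (a ℕ.* (i ℕ.* i) ℕ.+ b ℕ.* (j ℕ.* j) ℕ.+ c ℕ.* (k ℕ.* k)) ℕ.% d ≡ r ℕ.% d
    reduce M x y z root =
      +≡*+⇒%≡ d (M - + e * (+ a * A x + + b * A y + + c * A z)) (begin
        + (a ℕ.* (i ℕ.* i) ℕ.+ b ℕ.* (j ℕ.* j) ℕ.+ c ℕ.* (k ℕ.* k))
          ≡⟨ pos-weighted a b c (i ℕ.* i) (j ℕ.* j) (k ℕ.* k) ⟩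
        + a * + (i ℕ.* i) + + b * + (j ℕ.* j) + + c * + (k ℕ.* k)
          ≡⟨ weighted-cong (+ a) (+ b) (+ c) (square x) (square y) (square z) ⟩
        + a * (x * x - + d * + e * A x) + + b * (y * y - + d * + e * A y)
        + + c * (z * z - + d * + e * A z)
          ≡⟨ regroup (+ a) (+ b) (+ c) (+ d) (+ e) (+ r) M (x * x) (y * y) (z * z) (A x) (A y) (A z) ⟩
        Quadratic a b c (+ d * M + + r) x y z
        + (+ d * (M - + e * (+ a * A x + + b * A y + + c * A z)) + + r)
          ≡⟨ cong (_+ (+ d * (M - + e * (+ a * A x + + b * A y + + c * A z)) + + r)) root ⟩
        0ℤ + (+ d * (M - + e * (+ a * A x + + b * A y + + c * A z)) + + r)
          ≡⟨ ℤ.+-identityˡ _ ⟩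
        + d * (M - + e * (+ a * A x + + b * A y + + c * A z)) + + r ∎)
      where
      open ≡-Reasoning
      i = toℕ (residue x)
      j = toℕ (residue y)
      k = toℕ (residue z)
      -- For x = 4q + i this is (x² - i²)/8 = 2q² + qi, the multiple of 8 by which the two squares
      -- differ.
      A : ℤ → ℤ
      A x = + 2 * ((x /ℕ 4) * (x /ℕ 4)) + (x /ℕ 4) * + toℕ (residue x)
      expand : ∀ q i → i * i ≡ (+ 4 * q + i) * (+ 4 * q + i) - + 8 * (+ 2 * (q * q) + q * i)
      expand = solve-∀
      square : ∀ x → + (toℕ (residue x) ℕ.* toℕ (residue x)) ≡ x * x - + d * + e * A x
      square x = begin
        + (toℕ (residue x) ℕ.* toℕ (residue x))
          ≡⟨ ℤ.pos-* (toℕ (residue x)) (toℕ (residue x)) ⟩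
        + toℕ (residue x) * + toℕ (residue x)
          ≡⟨ expand (x /ℕ 4) (+ toℕ (residue x)) ⟩
        (+ 4 * (x /ℕ 4) + + toℕ (residue x)) * (+ 4 * (x /ℕ 4) + + toℕ (residue x)) - + 8 * A x
          ≡⟨ cong₂ (λ w m → w * w - m * A x) (sym (residue-class x)) 8≡d*e ⟩
        x * x - + d * + e * A x ∎
      regroup : ∀ a b c d e r M X Y Z P Q R →
        a * (X - d * e * P) + b * (Y - d * e * Q) + c * (Z - d * e * R)
        ≡ (a * X + b * Y + c * Z - (d * M + r)) + (d * (M - e * (a * P + b * Q + c * R)) + r)
      regroup = solve-∀

    -- Among the 64 residue triples, those that satisfy the congruence must give `f` the value `v`;
    -- `f` selects a residue, a parity or the parity of a difference.
    Sieve : (ℕ → ℕ → ℕ → ℕ) → ℕ → Set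
    Sieve f v = ∀ (i j k : Fin 4) →
      (a ℕ.* (toℕ i ℕ.* toℕ i) ℕ.+ b ℕ.* (toℕ j ℕ.* toℕ j) ℕ.+ c ℕ.* (toℕ k ℕ.* toℕ k)) ℕ.% d
        ≡ r ℕ.% d →
      f (toℕ i) (toℕ j) (toℕ k) ≡ v

    sieve? : ∀ f v → Dec (Sieve f v)
    sieve? f v = all? λ i → all? λ j → all? λ k → (_ ℕ.≟ _) →-dec (f (toℕ i) (toℕ j) (toℕ k) ℕ.≟ v)

    -- For numerals the argument of type `True` is found by evaluation, so that each use settles its
    -- congruence by computation.
    sieve : ∀ f v {_ : True (sieve? f v)} M x y z →
      Quadratic a b c (+ d * M + + r) x y z ≡ 0ℤ →
      f (toℕ (residue x)) (toℕ (residue y)) (toℕ (residue z)) ≡ v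
    sieve f v {holds} M x y z root = toWitness holds _ _ _ (reduce M x y z root)

  -- Splitting by parity and the doubling principle

  2x+0≢2y+1 : ∀ x y → + 2 * x + + 0 ≢ + 2 * y + + 1
  2x+0≢2y+1 x y e with +≡*+⇒%≡ 2 (x - y) {1} {0} (begin
      + 1                                          ≡⟨ cancelˡ (+ 2 * y) ⟩
      (+ 2 * y + + 1) - + 2 * y                    ≡⟨ cong (_- + 2 * y) e ⟨
      (+ 2 * x + + 0) - + 2 * y                    ≡⟨ regroup x y ⟩
      + 2 * (x - y) + + 0                          ∎)
    where
    open ≡-Reasoning
    cancelˡ : ∀ i → + 1 ≡ (i + + 1) - i
    cancelˡ = solve-∀
    regroup : ∀ x y → (+ 2 * x + + 0) - + 2 * y ≡ + 2 * (x - y) + + 0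
    regroup = solve-∀
  ... | ()

  parity : ∀ x → Class (+ 2) (+ 0) x ⊎ Class (+ 2) (+ 1) x
  parity x with toℕ (residue x) ℕ.% 2 in eq | ℕ.m%n<n (toℕ (residue x)) 2
  ... | 0 | _ = inj₁ (parity-class x eq)
  ... | 1 | _ = inj₂ (parity-class x eq)
  ... | suc (suc _) | s≤s (s≤s ())

  -- The even part keeps the summand `+ 0`, so that both parts have the shape mu + r of a residue
  -- class.
  split-parity : ∀ {F} → Sol F ↔
    (Sol (λ u y z → F (+ 2 * u + + 0) y z) ⊎ Sol (λ u y z → F (+ 2 * u + + 1) y z))
  split-parity {F} = ↔-sym (bijection join join-injective join-surjective)
    where
    Even Odd : Set
    Even = Sol (λ u y z → F (+ 2 * u + + 0) y z)
    Odd  = Sol (λ u y z → F (+ 2 * u + + 1) y z)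
    join : Even ⊎ Odd → Sol F
    join (inj₁ (sol u y z e)) = sol (+ 2 * u + + 0) y z e
    join (inj₂ (sol u y z e)) = sol (+ 2 * u + + 1) y z e
    join-injective : ∀ {a a′} → join a ≡ join a′ → a ≡ a′
    join-injective {inj₁ _} {inj₁ _} e = cong inj₁
      (Sol-≡ (rescale-injective (+ 2) (+ 0) (cong Sol.x e)) (cong Sol.y e) (cong Sol.z e))
    join-injective {inj₂ _} {inj₂ _} e = cong inj₂
      (Sol-≡ (rescale-injective (+ 2) (+ 1) (cong Sol.x e)) (cong Sol.y e) (cong Sol.z e))
    join-injective {inj₁ s} {inj₂ s′} e = ⊥-elim (2x+0≢2y+1 (Sol.x s) (Sol.x s′) (cong Sol.x e))
    join-injective {inj₂ s} {inj₁ s′} e = ⊥-elim (2x+0≢2y+1 (Sol.x s′) (Sol.x s) (sym (cong Sol.x e)))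
    join-surjective : ∀ s → Σ (Even ⊎ Odd) (λ a → join a ≡ s)
    join-surjective (sol x y z e) with parity x
    ... | inj₁ (u , refl) = inj₁ (sol u y z e) , refl
    ... | inj₂ (u , refl) = inj₂ (sol u y z e) , refl

  -- With X = 2x + 1 and Y = 2y + 1, the symmetry y ↦ -y - 1 is Y ↦ -Y, and exactly one
  -- of X ≡ Y, X ≡ -Y (mod 4) holds.
  split-reflection : ∀ {F} → (∀ x y z → F x (- y - + 1) z ≡ F x y z) →
    Sol F ↔ (Sol (λ u q z → F (u + + 2 * q) u z) ⊎ Sol (λ u q z → F (u + + 2 * q) u z))
  -- X - Y is twice the sheared coordinate, so the parity of that coordinate decides which of the
  -- two congruences holds.
  split-reflection {F} reflect = shear ⟫ split-parity ⟫ (same ⊎-↔ opposite)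
    where
    comm : ∀ u q → + 2 * q + + 0 + u ≡ u + + 2 * q
    comm = solve-∀
    same : Sol (λ q u z → F (+ 2 * q + + 0 + u) u z) ↔ Sol (λ u q z → F (u + + 2 * q) u z)
    same = swap₁₂ ⟫ Sol-cong (λ u q z → cong (λ x → F x u z) (comm u q))
    opposite : Sol (λ d y z → F (+ 2 * d + + 1 + y) y z) ↔ Sol (λ u q z → F (u + + 2 * q) u z)
    -- Here x = 2d + 1 + y. With u = -y - 1 the difference x - u is 2(d + y + 1), so q = d + y + 1,
    -- and `reflect` turns the second argument back into u.
    opposite =
      substitute (λ u q → q + u) (λ u q → - u - + 1) (λ d y → - y - + 1) (λ d y → d + y + + 1)
        φψ₁ φψ₂ (λ u q → φψ₂ u u) ψφ₂
      ⟫ Sol-cong (λ u q z → trans (reflect (+ 2 * (q + u) + + 1 + (- u - + 1)) u z)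
                              (cong (λ x → F x u z) (simplify u q)))
      where
      φψ₁ : ∀ d y → d + y + + 1 + (- y - + 1) ≡ d
      φψ₁ = solve-∀
      φψ₂ : ∀ (d y : ℤ) → - (- y - + 1) - + 1 ≡ y
      φψ₂ = solve-∀
      ψφ₂ : ∀ u q → q + u + (- u - + 1) + + 1 ≡ q
      ψφ₂ = solve-∀
      simplify : ∀ u q → + 2 * (q + u) + + 1 + (- u - + 1) ≡ u + + 2 * q
      simplify = solve-∀

  -- The third variable enters only through `g`, which the change of variables leaves alone.
  double-x²+3y² : ∀ b (g : ℤ → ℤ) →
    (∀ x y z → b * (x * x + + 3 * (y * y)) + g z ≡ 0ℤ → Class (+ 2) (+ 1) (x - y)) →
    let R = Sol (λ x y z → b * (x * x + + 3 * (y * y)) + g z) in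
    Sol (λ x y z → b * ((+ 2 * x + + 1) * (+ 2 * x + + 1) + + 3 * ((+ 2 * y + + 1) * (+ 2 * y + + 1)))
      + + 4 * g z) ↔ (R ⊎ R)
  double-x²+3y² b g odd = split-reflection (λ x y z → reflect b x y (g z)) ⟫ (half ⊎-↔ half)
    where
    R = λ x y z → b * (x * x + + 3 * (y * y)) + g z
    reflect : ∀ b x y m →
      b * ((+ 2 * x + + 1) * (+ 2 * x + + 1)
           + + 3 * ((+ 2 * (- y - + 1) + + 1) * (+ 2 * (- y - + 1) + + 1))) + + 4 * m
      ≡ b * ((+ 2 * x + + 1) * (+ 2 * x + + 1) + + 3 * ((+ 2 * y + + 1) * (+ 2 * y + + 1))) + + 4 * m
    reflect = solve-∀
    quarter : ∀ b u q m →
      b * ((+ 2 * (u + + 2 * q) + + 1) * (+ 2 * (u + + 2 * q) + + 1)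
           + + 3 * ((+ 2 * u + + 1) * (+ 2 * u + + 1))) + + 4 * m
      ≡ + 4 * (b * ((+ 2 * u + + 1 + q) * (+ 2 * u + + 1 + q) + + 3 * (q * q)) + m)
    quarter = solve-∀
    cancel : ∀ d y → d + y - y ≡ d
    cancel = solve-∀
    -- After division by 4 the coordinates are Y + q and q, with the odd difference Y = 2u + 1. By
    -- `odd` every root of `R` has an odd difference, so each arises in this way exactly once.
    half = Sol-scale (+ 4) (λ u q z → quarter b u q (g z))
      ⟫ ↔-sym (shear {R} ⟫ rescale₁ (+ 2) (+ 1)
          (λ d y z e → subst (Class (+ 2) (+ 1)) (cancel d y) (odd (d + y) y z e)))

  -- In X² + Y² = 2((Y + 2q)² + 4q²) the number Y + 2q = 2(u + q) + 1 runs over all odd integers for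
  -- each fixed q, so a shear identifies each half with `R`.
  double-x²+y² : ∀ b (g : ℤ → ℤ) →
    let R = Sol (λ x y z → b * (+ 2 * ((+ 2 * x + + 1) * (+ 2 * x + + 1) + + 4 * (y * y))) + g z) in
    Sol (λ x y z → b * ((+ 2 * x + + 1) * (+ 2 * x + + 1) + (+ 2 * y + + 1) * (+ 2 * y + + 1)) + g z)
      ↔ (R ⊎ R)
  double-x²+y² b g = split-reflection (λ x y z → reflect b x y (g z)) ⟫ (half ⊎-↔ half)
    where
    R = λ x y z → b * (+ 2 * ((+ 2 * x + + 1) * (+ 2 * x + + 1) + + 4 * (y * y))) + g z
    reflect : ∀ b x y m →
      b * ((+ 2 * x + + 1) * (+ 2 * x + + 1) + (+ 2 * (- y - + 1) + + 1) * (+ 2 * (- y - + 1) + + 1)) + m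
      ≡ b * ((+ 2 * x + + 1) * (+ 2 * x + + 1) + (+ 2 * y + + 1) * (+ 2 * y + + 1)) + m
    reflect = solve-∀
    parallelogram : ∀ b u q m →
      b * ((+ 2 * (u + + 2 * q) + + 1) * (+ 2 * (u + + 2 * q) + + 1) + (+ 2 * u + + 1) * (+ 2 * u + + 1)) + m
      ≡ b * (+ 2 * ((+ 2 * (u + q) + + 1) * (+ 2 * (u + q) + + 1) + + 4 * (q * q))) + m
    parallelogram = solve-∀
    half = Sol-cong (λ u q z → parallelogram b u q (g z)) ⟫ ↔-sym (shear {R})

  triple-x²+3y² : ∀ b c m →
    (∀ x y z → b * (x * x + + 3 * (y * y)) + + 4 * (c * (z * z) - m) ≡ 0ℤ → Class (+ 2) (+ 0) (x - y)) →
    (∀ x y z → b * (x * x + + 3 * (y * y)) + (c * (z * z) - m) ≡ 0ℤ → Class (+ 2) (+ 1) (x - y)) →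
    let R = Sol (λ x y z → b * (x * x + + 3 * (y * y)) + (c * (z * z) - m)) in
    Sol (λ x y z → b * (x * x + + 3 * (y * y)) + + 4 * (c * (z * z) - m)) ↔ (R ⊎ (R ⊎ R))
  triple-x²+3y² b c m even odd = split-parity ⟫ (both-even ⊎-↔ both-odd)
    where
    F = λ x y z → b * (x * x + + 3 * (y * y)) + + 4 * (c * (z * z) - m)
    same-parity : ∀ r u y → Class (+ 2) (+ 0) ((+ 2 * u + r) - y) → Class (+ 2) r y
    same-parity r u y (v , e) = u - v , (begin
      y                               ≡⟨ isolate (+ 2 * u + r) y ⟩
      (+ 2 * u + r) - (+ 2 * u + r - y)   ≡⟨ cong (λ i → (+ 2 * u + r) - i) e ⟩
      (+ 2 * u + r) - (+ 2 * v + + 0)     ≡⟨ regroup u v r ⟩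
      + 2 * (u - v) + r               ∎)
      where
      open ≡-Reasoning
      isolate : ∀ i y → y ≡ i - (i - y)
      isolate = solve-∀
      regroup : ∀ u v r → (+ 2 * u + r) - (+ 2 * v + + 0) ≡ + 2 * (u - v) + r
      regroup = solve-∀
    quarter : ∀ b u v n → b * ((+ 2 * u + + 0) * (+ 2 * u + + 0) + + 3 * ((+ 2 * v + + 0) * (+ 2 * v + + 0))) + + 4 * n
      ≡ + 4 * (b * (u * u + + 3 * (v * v)) + n)
    quarter = solve-∀
    -- Halving x and y cancels the factor 4 and gives one copy of `R`; in the odd case the doubling
    -- principle gives two.
    both-even = rescale₂ {λ u y z → F (+ 2 * u + + 0) y z} (+ 2) (+ 0)
        (λ u y z e → same-parity (+ 0) u y (even (+ 2 * u + + 0) y z e))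
      ⟫ Sol-scale (+ 4) (λ u v z → quarter b u v (c * (z * z) - m))
    both-odd = rescale₂ {λ u y z → F (+ 2 * u + + 1) y z} (+ 2) (+ 1)
        (λ u y z e → same-parity (+ 1) u y (even (+ 2 * u + + 1) y z e))
      ⟫ double-x²+3y² b (λ z → c * (z * z) - m) odd

  -- Permutations, sizes and the general four-thirds identity

  rotate : ∀ {F} → Sol F ↔ Sol (λ x y z → F z x y)
  rotate = swap₁₂ ⟫ swap₂₃

  rotate⁻¹ : ∀ {F} → Sol F ↔ Sol (λ x y z → F y z x)
  rotate⁻¹ = swap₂₃ ⟫ swap₁₂

  reverse : ∀ {F} → Sol F ↔ Sol (λ x y z → F z y x)
  reverse = rotate ⟫ swap₁₂

  size-unique : ∀ {m n} {A : Set} → Fin m ↔ A → Fin n ↔ A → m ≡ n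
  size-unique m↔A n↔A = ↔⇒≡ (m↔A ⟫ ↔-sym n↔A)

  ⊎-size : ∀ {m n} {A B : Set} → Fin m ↔ A → Fin n ↔ B → Fin (m ℕ.+ n) ↔ (A ⊎ B)
  ⊎-size m↔A n↔B = +↔⊎ ⟫ (m↔A ⊎-↔ n↔B)

  -- 3j stands for -j modulo 4, avoiding truncated subtraction.
  difference : ℕ → ℕ → ℕ → ℕ
  difference i j k = (i ℕ.+ 3 ℕ.* j) ℕ.% 2

  Separates : ℕ → ℕ → ℕ → ℕ → ℕ → Set
  Separates a b c r p = True (sieve? 4 2 refl a b c r difference p)

  sieve-difference : ∀ a b c r p {_ : Separates a b c r p} M x y z →
    Quadratic a b c (+ 4 * M + + r) x y z ≡ 0ℤ → Class (+ 2) (+ p) (x - y)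
  sieve-difference a b c r p {separates} M x y z root =
    difference-class x y (sieve 4 2 refl a b c r difference p {separates} M x y z root)

  pos-affine : ∀ {n} a k b → n ≡ a ℕ.* k ℕ.+ b → + n ≡ + a * + k + + b
  pos-affine a k b refl = cong (_+ + b) (ℤ.pos-* a k)

  -- The hypotheses on r′ ≡ -c (mod 4) say that every solution of b(x² + 3y²) + cz² = 4L with
  -- z odd has x ≡ p and y ≡ q (mod 2), where p + q is odd.
  t≡4/3*N : ∀ b c r j s r′ p q {n} {{_ : ℕ.NonZero b}} {{_ : ℕ.NonZero (3 ℕ.* b)}}
    {{_ : ℕ.NonZero c}} {{_ : ℕ.NonZero (4 ℕ.* c)}}
    {_ : Separates b (3 ℕ.* b) c r 1}
    {_ : Separates b (3 ℕ.* b) (4 ℕ.* c) 0 0}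
    {_ : Separates b (3 ℕ.* b) 0 r′ 1}
    {_ : True (sieve? 4 2 refl b (3 ℕ.* b) 0 r′ (λ i _ _ → i ℕ.% 2) p)}
    {_ : True (sieve? 4 2 refl b (3 ℕ.* b) 0 r′ (λ _ j _ → j ℕ.% 2) q)} →
    let L = + 4 * + j + + r in
    + c ≡ + 4 * + s - + r′ → 2 ℕ.* n ℕ.+ (b ℕ.+ c) ≡ 4 ℕ.* (4 ℕ.* j ℕ.+ r) →
    (let C = Sol (λ x y z → + b * (x * x + + 3 * (y * y)) + (+ c * (z * z) - L)) in
     Sol (λ x y z → + b * ((+ 2 * x + + p) * (+ 2 * x + + p) + + 3 * ((+ 2 * y + + q) * (+ 2 * y + + q)))
       + (+ c * ((+ 2 * z + + 1) * (+ 2 * z + + 1)) - + 4 * L)) ↔ (C ⊎ C)) →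
    3 ℕ.* t b (3 ℕ.* b) (4 ℕ.* c) n ≡ 4 ℕ.* N b (3 ℕ.* b) (4 ℕ.* c) (2 ℕ.* n ℕ.+ (b ℕ.+ c))
  t≡4/3*N b c r j s r′ p q {n} {separates} {separates₄} {separates₀} {p-sieve} {q-sieve}
    c≡ 2n+b+c≡ A′↔2C = begin
    -- Since `v` counts `C`, the two counts are t = 4v and N = 3v, and both sides equal 12v.
    3 ℕ.* t b 3b 4c n                       ≡⟨ cong (3 ℕ.*_) (size-unique t↔2A (⊎-size a↔A a↔A)) ⟩
    3 ℕ.* ((v ℕ.+ v) ℕ.+ (v ℕ.+ v))         ≡⟨ regroup v ⟩
    4 ℕ.* (v ℕ.+ (v ℕ.+ v))                 ≡⟨ cong (4 ℕ.*_) (size-unique N↔3C (⊎-size v↔C (⊎-size v↔C v↔C))) ⟨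
    4 ℕ.* N b 3b 4c m                       ∎
    where
    open ≡-Reasoning
    3b = 3 ℕ.* b
    4c = 4 ℕ.* c
    m = 2 ℕ.* n ℕ.+ (b ℕ.+ c)
    L = + 4 * + j + + r
    v = N b 3b c (4 ℕ.* j ℕ.+ r)

    m≡ : + m ≡ + 4 * L
    m≡ = trans (cong +_ 2n+b+c≡) (trans (ℤ.pos-* 4 (4 ℕ.* j ℕ.+ r)) (cong (+ 4 *_) (pos-affine 4 j r refl)))

    2n≡ : + 2 * + n + + b + + c ≡ + 4 * L
    2n≡ = trans (ℤ.+-assoc (+ 2 * + n) (+ b) (+ c)) (trans (sym (pos-affine 2 n (b ℕ.+ c) refl)) m≡)

    g : ℤ → ℤ
    g z = + c * ((+ 2 * z + + 1) * (+ 2 * z + + 1)) - + 4 * L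

    C A : ℤ → ℤ → ℤ → ℤ
    C x y z = + b * (x * x + + 3 * (y * y)) + (+ c * (z * z) - L)
    A x y z = + b * (x * x + + 3 * (y * y)) + g z

    C-form : ∀ x y z → Quadratic b 3b c L x y z ≡ C x y z
    C-form x y z = trans (cong (λ d → + b * (x * x) + d * (y * y) + + c * (z * z) - L) (ℤ.pos-* 3 b))
      (form (+ b) (+ c) L x y z)
      where
      form : ∀ b c L x y z → b * (x * x) + + 3 * b * (y * y) + c * (z * z) - L
        ≡ b * (x * x + + 3 * (y * y)) + (c * (z * z) - L)
      form = solve-∀

    -- The summand `+ 0` gives the target the shape 4M + r of the sieve, with r = 0.
    N-form : ∀ x y z → Quadratic b 3b 4c (+ 4 * L + + 0) x y z
      ≡ + b * (x * x + + 3 * (y * y)) + + 4 * (+ c * (z * z) - L)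
    N-form x y z = trans (cong₂ (λ d e → + b * (x * x) + d * (y * y) + e * (z * z) - (+ 4 * L + + 0))
      (ℤ.pos-* 3 b) (ℤ.pos-* 4 c)) (form (+ b) (+ c) L x y z)
      where
      form : ∀ b c L x y z → b * (x * x) + + 3 * b * (y * y) + + 4 * c * (z * z) - (+ 4 * L + + 0)
        ≡ b * (x * x + + 3 * (y * y)) + + 4 * (c * (z * z) - L)
      form = solve-∀

    -- For odd Z = 2z + 1, cZ² = 4c(z² + z) + c with c = 4s - r′. Moved to the right it leaves a
    -- binary form in x and y that is r′ modulo 4, so the sieve is run with third coefficient and
    -- third variable 0.
    A-form : ∀ x y z → Quadratic b 3b 0 (+ 4 * (L - + c * (z * z + z) - + s) + + r′) x y 0ℤ ≡ A x y z
    A-form x y z = begin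
      Quadratic b 3b 0 (+ 4 * (L - + c * (z * z + z) - + s) + + r′) x y 0ℤ
        ≡⟨ cong (λ d → + b * (x * x) + d * (y * y) + + 0 * (0ℤ * 0ℤ)
                       - (+ 4 * (L - + c * (z * z + z) - + s) + + r′)) (ℤ.pos-* 3 b) ⟩
      + b * (x * x) + + 3 * + b * (y * y) + + 0 * (0ℤ * 0ℤ)
      - (+ 4 * (L - + c * (z * z + z) - + s) + + r′)
        ≡⟨ form (+ b) (+ c) L (+ s) (+ r′) x y z ⟩
      + b * (x * x + + 3 * (y * y)) + (+ c * (+ 4 * (z * z + z)) + (+ 4 * + s - + r′) - + 4 * L)
        ≡⟨ cong (λ d → + b * (x * x + + 3 * (y * y)) + (+ c * (+ 4 * (z * z + z)) + d - + 4 * L)) c≡ ⟨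
      + b * (x * x + + 3 * (y * y)) + (+ c * (+ 4 * (z * z + z)) + + c - + 4 * L)
        ≡⟨ form′ (+ b) (+ c) L x y z ⟩
      A x y z ∎
      where
      form : ∀ b c L s r x y z → b * (x * x) + + 3 * b * (y * y) + + 0 * (+ 0 * + 0)
        - (+ 4 * (L - c * (z * z + z) - s) + r)
        ≡ b * (x * x + + 3 * (y * y)) + (c * (+ 4 * (z * z + z)) + (+ 4 * s - r) - + 4 * L)
      form = solve-∀
      form′ : ∀ b c L x y z →
        b * (x * x + + 3 * (y * y)) + (c * (+ 4 * (z * z + z)) + c - + 4 * L)
        ≡ b * (x * x + + 3 * (y * y)) + (c * ((+ 2 * z + + 1) * (+ 2 * z + + 1)) - + 4 * L)
      form′ = solve-∀

    t-form : ∀ x y z →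
      + b * ((+ 2 * x + + 1) * (+ 2 * x + + 1)) + + 3b * ((+ 2 * y + + 1) * (+ 2 * y + + 1))
      + + 4c * ((+ 2 * z + + 1) * (+ 2 * z + + 1)) - (+ 8 * + n + + b + + 3b + + 4c)
      ≡ + b * ((+ 2 * x + + 1) * (+ 2 * x + + 1) + + 3 * ((+ 2 * y + + 1) * (+ 2 * y + + 1)))
        + + 4 * g z
    t-form x y z = trans (cong₂ (λ d e →
        + b * ((+ 2 * x + + 1) * (+ 2 * x + + 1)) + d * ((+ 2 * y + + 1) * (+ 2 * y + + 1))
        + e * ((+ 2 * z + + 1) * (+ 2 * z + + 1)) - (+ 8 * + n + + b + d + e))
        (ℤ.pos-* 3 b) (ℤ.pos-* 4 c))
      (trans (form (+ b) (+ c) (+ n) x y z)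
      (cong (λ i →
          + b * ((+ 2 * x + + 1) * (+ 2 * x + + 1) + + 3 * ((+ 2 * y + + 1) * (+ 2 * y + + 1)))
          + + 4 * (+ c * ((+ 2 * z + + 1) * (+ 2 * z + + 1)) - i)) 2n≡))
      where
      form : ∀ b c n x y z →
        b * ((+ 2 * x + + 1) * (+ 2 * x + + 1)) + + 3 * b * ((+ 2 * y + + 1) * (+ 2 * y + + 1))
        + + 4 * c * ((+ 2 * z + + 1) * (+ 2 * z + + 1)) - (+ 8 * n + b + + 3 * b + + 4 * c)
        ≡ b * ((+ 2 * x + + 1) * (+ 2 * x + + 1) + + 3 * ((+ 2 * y + + 1) * (+ 2 * y + + 1)))
          + + 4 * (c * ((+ 2 * z + + 1) * (+ 2 * z + + 1)) - (+ 2 * n + b + c))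
      form = solve-∀

    A-sieve : ∀ f u {_ : True (sieve? 4 2 refl b 3b 0 r′ f u)} x y z → A x y z ≡ 0ℤ →
      f (toℕ (residue x)) (toℕ (residue y)) (toℕ (residue 0ℤ)) ≡ u
    A-sieve f u {holds} x y z root = sieve 4 2 refl b 3b 0 r′ f u {holds}
      (L - + c * (z * z + z) - + s) x y 0ℤ (trans (A-form x y z) root)

    v↔C : Fin v ↔ Sol C
    v↔C = N-↔ b 3b c (4 ℕ.* j ℕ.+ r) (pos-affine 4 j r refl) ⟫ Sol-cong C-form

    A↔2C : Sol A ↔ (Sol C ⊎ Sol C)
    A↔2C =
      -- The parities of x and y are now fixed, and the second doubling, which depends on the form,
      -- is supplied by `A′↔2C`.
      rescale₁ (+ 2) (+ p) (λ x y z root →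
        parity-class x (A-sieve (λ i _ _ → i ℕ.% 2) p {p-sieve} x y z root))
      ⟫ rescale₂ (+ 2) (+ q) (λ u y z root →
        parity-class y (A-sieve (λ _ j _ → j ℕ.% 2) q {q-sieve} (+ 2 * u + + p) y z root))
      ⟫ A′↔2C

    t↔2A : Fin (t b 3b 4c n) ↔ (Sol A ⊎ Sol A)
    t↔2A = t-↔ b 3b 4c n refl ⟫ Sol-cong t-form ⟫ double-x²+3y² (+ b) g (λ x y z root →
      difference-class x y (A-sieve difference 1 {separates₀} x y z root))

    N↔3C : Fin (N b 3b 4c m) ↔ (Sol C ⊎ (Sol C ⊎ Sol C))
    N↔3C = N-↔ b 3b 4c m (trans m≡ (sym (ℤ.+-identityʳ _))) ⟫ Sol-cong N-form ⟫
      triple-x²+3y² (+ b) (+ c) L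
        (λ x y z root → sieve-difference b 3b 4c 0 0 {separates₄} L x y z (trans (N-form x y z) root))
        (λ x y z root → sieve-difference b 3b c r 1 {separates} (+ j) x y z (trans (C-form x y z) root))

    a↔A : Fin (v ℕ.+ v) ↔ Sol A
    a↔A = ⊎-size v↔C v↔C ⟫ ↔-sym A↔2C

    regroup : ∀ v → 3 ℕ.* ((v ℕ.+ v) ℕ.+ (v ℕ.+ v)) ≡ 4 ℕ.* (v ℕ.+ (v ℕ.+ v))
    regroup = ℕ-solve-∀

  -- The four forms with factor 4/3

  module _ (r j : ℕ) where
    L = + 4 * + j + + r

    -- For odd z, x² + 3y² ≡ 3 (mod 4) makes x even and y odd. The second doubling acts on z² + 3y²,
    -- and halving x gives back the form x² + 3y² + z².
    t⟨1,3,4⟩ : ∀ {n} {_ : Separates 1 3 1 r 1} → 2 ℕ.* n ℕ.+ 2 ≡ 4 ℕ.* (4 ℕ.* j ℕ.+ r) →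
      3 ℕ.* t 1 3 4 n ≡ 4 ℕ.* N 1 3 4 (2 ℕ.* n ℕ.+ 2)
    t⟨1,3,4⟩ {n} {separates} 2n+2≡ = t≡4/3*N 1 1 r j 1 3 0 1 {n} {separates} refl 2n+2≡
      (reverse ⟫ Sol-cong (regroup L) ⟫ double-x²+3y² (+ 1) (λ z → + 1 * (z * z) - L)
        (λ x y z root → sieve-difference 1 3 1 r 1 {separates} (+ j) x y z
          (trans (form L x y z) root)))
      where
      regroup : ∀ L x y z →
        + 1 * ((+ 2 * z + + 0) * (+ 2 * z + + 0) + + 3 * ((+ 2 * y + + 1) * (+ 2 * y + + 1)))
        + (+ 1 * ((+ 2 * x + + 1) * (+ 2 * x + + 1)) - + 4 * L)
        ≡ + 1 * ((+ 2 * x + + 1) * (+ 2 * x + + 1) + + 3 * ((+ 2 * y + + 1) * (+ 2 * y + + 1)))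
          + + 4 * (+ 1 * (z * z) - L)
      regroup = solve-∀
      form : ∀ L x y z → + 1 * (x * x) + + 3 * (y * y) + + 1 * (z * z) - L
        ≡ + 1 * (x * x + + 3 * (y * y)) + (+ 1 * (z * z) - L)
      form = solve-∀

    -- For odd z, x² + 3y² ≡ 1 (mod 4) makes x odd and y even. The second doubling acts on x² + 3z²,
    -- with y halved.
    t⟨1,3,12⟩ : ∀ {n} {_ : Separates 1 3 3 r 1} → 2 ℕ.* n ℕ.+ 4 ≡ 4 ℕ.* (4 ℕ.* j ℕ.+ r) →
      3 ℕ.* t 1 3 12 n ≡ 4 ℕ.* N 1 3 12 (2 ℕ.* n ℕ.+ 4)
    t⟨1,3,12⟩ {n} {separates} 2n+4≡ = t≡4/3*N 1 3 r j 1 1 1 0 {n} {separates} refl 2n+4≡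
      (swap₂₃ ⟫ Sol-cong (regroup L) ⟫ double-x²+3y² (+ 1) (λ z → + 3 * (z * z) - L)
        (λ x y z root → sieve-difference 1 3 3 r 1 {separates} (+ j) x y z
          (trans (form L x y z) root)))
      where
      regroup : ∀ L x z y →
        + 1 * ((+ 2 * x + + 1) * (+ 2 * x + + 1) + + 3 * ((+ 2 * y + + 0) * (+ 2 * y + + 0)))
        + (+ 3 * ((+ 2 * z + + 1) * (+ 2 * z + + 1)) - + 4 * L)
        ≡ + 1 * ((+ 2 * x + + 1) * (+ 2 * x + + 1) + + 3 * ((+ 2 * z + + 1) * (+ 2 * z + + 1)))
          + + 4 * (+ 3 * (y * y) - L)
      regroup = solve-∀
      form : ∀ L x y z → + 1 * (x * x) + + 3 * (y * y) + + 3 * (z * z) - L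
        ≡ + 1 * (x * x + + 3 * (y * y)) + (+ 3 * (z * z) - L)
      form = solve-∀

    -- Here x is even and y is odd, and 3y² + 9z² = 3(y² + 3z²) is doubled. The result 3x² + 9y² +
    -- z² is the form x² + 3y² + 9z² with its variables rotated, which `back` undoes.
    t⟨1,3,36⟩ : ∀ {n} {_ : Separates 1 3 9 r 1} {_ : Separates 3 9 1 r 1} →
      2 ℕ.* n ℕ.+ 10 ≡ 4 ℕ.* (4 ℕ.* j ℕ.+ r) →
      3 ℕ.* t 1 3 36 n ≡ 4 ℕ.* N 1 3 36 (2 ℕ.* n ℕ.+ 10)
    t⟨1,3,36⟩ {n} {separates} {separates′} 2n+10≡ =
      t≡4/3*N 1 9 r j 3 3 0 1 {n} {separates} refl 2n+10≡
      (rotate ⟫ Sol-cong (regroup L) ⟫ double-x²+3y² (+ 3) (λ z → + 1 * (z * z) - L)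
        (λ x y z root → sieve-difference 3 9 1 r 1 {separates′} (+ j) x y z
          (trans (form L x y z) root))
        ⟫ (back ⊎-↔ back))
      where
      regroup : ∀ L y z x →
        + 1 * ((+ 2 * x + + 0) * (+ 2 * x + + 0) + + 3 * ((+ 2 * y + + 1) * (+ 2 * y + + 1)))
        + (+ 9 * ((+ 2 * z + + 1) * (+ 2 * z + + 1)) - + 4 * L)
        ≡ + 3 * ((+ 2 * y + + 1) * (+ 2 * y + + 1) + + 3 * ((+ 2 * z + + 1) * (+ 2 * z + + 1)))
          + + 4 * (+ 1 * (x * x) - L)
      regroup = solve-∀
      form : ∀ L x y z → + 3 * (x * x) + + 9 * (y * y) + + 1 * (z * z) - L
        ≡ + 3 * (x * x + + 3 * (y * y)) + (+ 1 * (z * z) - L)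
      form = solve-∀
      reorder : ∀ L x y z → + 3 * (y * y + + 3 * (z * z)) + (+ 1 * (x * x) - L)
        ≡ + 1 * (x * x + + 3 * (y * y)) + (+ 9 * (z * z) - L)
      reorder = solve-∀
      back = rotate⁻¹ {λ x y z → + 3 * (x * x + + 3 * (y * y)) + (+ 1 * (z * z) - L)}
        ⟫ Sol-cong (reorder L)

    -- The mirror image of the previous case: x is odd, y is even, and z² + 3x² is doubled while 9y²
    -- plays the part of the third term.
    t⟨3,9,4⟩ : ∀ {n} {_ : Separates 3 9 1 r 1} {_ : Separates 1 3 9 r 1} →
      2 ℕ.* n ℕ.+ 4 ≡ 4 ℕ.* (4 ℕ.* j ℕ.+ r) →
      3 ℕ.* t 3 9 4 n ≡ 4 ℕ.* N 3 9 4 (2 ℕ.* n ℕ.+ 4)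
    t⟨3,9,4⟩ {n} {separates} {separates′} 2n+4≡ =
      t≡4/3*N 3 1 r j 1 3 1 0 {n} {separates} refl 2n+4≡
      (rotate⁻¹ ⟫ Sol-cong (regroup L) ⟫ double-x²+3y² (+ 1) (λ z → + 9 * (z * z) - L)
        (λ x y z root → sieve-difference 1 3 9 r 1 {separates′} (+ j) x y z
          (trans (form L x y z) root))
        ⟫ (back ⊎-↔ back))
      where
      regroup : ∀ L z x y →
        + 3 * ((+ 2 * x + + 1) * (+ 2 * x + + 1) + + 3 * ((+ 2 * y + + 0) * (+ 2 * y + + 0)))
        + (+ 1 * ((+ 2 * z + + 1) * (+ 2 * z + + 1)) - + 4 * L)
        ≡ + 1 * ((+ 2 * z + + 1) * (+ 2 * z + + 1) + + 3 * ((+ 2 * x + + 1) * (+ 2 * x + + 1)))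
          + + 4 * (+ 9 * (y * y) - L)
      regroup = solve-∀
      form : ∀ L x y z → + 1 * (x * x) + + 3 * (y * y) + + 9 * (z * z) - L
        ≡ + 1 * (x * x + + 3 * (y * y)) + (+ 9 * (z * z) - L)
      form = solve-∀
      reorder : ∀ L x y z → + 1 * (z * z + + 3 * (x * x)) + (+ 9 * (y * y) - L)
        ≡ + 3 * (x * x + + 3 * (y * y)) + (+ 1 * (z * z) - L)
      reorder = solve-∀
      back = rotate {λ x y z → + 1 * (x * x + + 3 * (y * y)) + (+ 9 * (z * z) - L)}
        ⟫ Sol-cong (reorder L)

  -- Exchange of coefficients

  swap-coefficients : ∀ a b c x y z m → a * x + c * z + b * y - m ≡ a * x + b * y + c * z - m
  swap-coefficients = solve-∀

  -- The general identity has its coefficients in the order b, 3b, 4c, so (3,4,9) is treated as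
  -- (3,9,4).
  N-swap₂₃ : ∀ a b c n {{_ : ℕ.NonZero a}} {{_ : ℕ.NonZero b}} {{_ : ℕ.NonZero c}} →
    N a b c n ≡ N a c b n
  N-swap₂₃ a b c n = size-unique (N-↔ a b c n refl) (N-↔ a c b n refl ⟫ swap₂₃ ⟫
    Sol-cong (λ x y z → swap-coefficients (+ a) (+ b) (+ c) (x * x) (y * y) (z * z) (+ n)))

  t-swap₂₃ : ∀ a b c n {{_ : ℕ.NonZero a}} {{_ : ℕ.NonZero b}} {{_ : ℕ.NonZero c}} →
    t a b c n ≡ t a c b n
  t-swap₂₃ a b c n = size-unique (t-↔ a b c n refl) (t-↔ a c b n m≡ ⟫ swap₂₃ ⟫
    Sol-cong (λ x y z → swap-coefficients (+ a) (+ b) (+ c) _ _ _ (+ 8 * + n + + a + + b + + c)))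
    where
    reorder : ∀ n a b c → + 8 * n + a + c + b ≡ + 8 * n + a + b + c
    reorder = solve-∀
    m≡ = reorder (+ n) (+ a) (+ b) (+ c)

  -- The two identities with factor 2

  double-size : ∀ {n} {A : Set} → Fin n ↔ A → Fin (2 ℕ.* n) ↔ (A ⊎ A)
  double-size {n} {A} n↔A = subst (λ m → Fin m ↔ (A ⊎ A)) (cong (n ℕ.+_) (sym (ℕ.+-identityʳ n))) (⊎-size n↔A n↔A)

  %8⇒≡ : ∀ n {r} → n ℕ.% 8 ≡ r → n ≡ r ℕ.+ n ℕ./ 8 ℕ.* 8
  %8⇒≡ n refl = ℕ.m≡m%n+[m/n]*n n 8

  -- All three counts lead to `W`, the solutions of (4x)² + 3Y² + 4Z² = 8k + 7 with Y, Z odd. For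
  -- the first t, doubling leaves x² + 3y² ≡ 3 (mod 8), so 4 divides x. For N, x² + 3y² ≡ 7 (mod 8)
  -- gives x = 2Z, while 16z² = (4z)². For the last t, 2(X² + Y²) becomes 4(Z² + 4x²).
  t[1,3,16]≡2N : ∀ {n} k → n ≡ 4 ℕ.* k ℕ.+ 1 →
    t 1 3 16 n ≡ 2 ℕ.* N 1 3 16 (2 ℕ.* n ℕ.+ 5) × 2 ℕ.* N 1 3 16 (2 ℕ.* n ℕ.+ 5) ≡ t 2 2 3 k
  t[1,3,16]≡2N {n} k n≡ = size-unique t↔2W 2N↔2W , size-unique 2N↔2W t′↔2W
    where
    K = + k
    M = + 8 * + k + + 7

    g : ℤ → ℤ
    g z = + 4 * ((+ 2 * z + + 1) * (+ 2 * z + + 1)) - M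

    R W : ℤ → ℤ → ℤ → ℤ
    R x y z = + 1 * (x * x + + 3 * (y * y)) + g z
    W x y z = + 1 * ((+ 4 * x + + 0) * (+ 4 * x + + 0) + + 3 * ((+ 2 * y + + 1) * (+ 2 * y + + 1))) + g z

    t-form : ∀ k x y z →
      + 1 * ((+ 2 * x + + 1) * (+ 2 * x + + 1)) + + 3 * ((+ 2 * y + + 1) * (+ 2 * y + + 1))
      + + 16 * ((+ 2 * z + + 1) * (+ 2 * z + + 1)) - (+ 8 * (+ 4 * k + + 1) + + 1 + + 3 + + 16)
      ≡ + 1 * ((+ 2 * x + + 1) * (+ 2 * x + + 1) + + 3 * ((+ 2 * y + + 1) * (+ 2 * y + + 1)))
        + + 4 * (+ 4 * ((+ 2 * z + + 1) * (+ 2 * z + + 1)) - (+ 8 * k + + 7))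
    t-form = solve-∀

    -- With Z = 2z + 1, 4Z² = 16(z² + z) + 4; taken from 8k + 7 it leaves 8(k - 2(z² + z)) + 3.
    R-form : ∀ k x y z →
      + 1 * (x * x) + + 3 * (y * y) + + 0 * (+ 0 * + 0) - (+ 8 * (k - + 2 * (z * z + z)) + + 3)
      ≡ + 1 * (x * x + + 3 * (y * y)) + (+ 4 * ((+ 2 * z + + 1) * (+ 2 * z + + 1)) - (+ 8 * k + + 7))
    R-form = solve-∀

    R-sieve : ∀ f v {_ : True (sieve? 8 1 refl 1 3 0 3 f v)} x y z → R x y z ≡ 0ℤ →
      f (toℕ (residue x)) (toℕ (residue y)) 0 ≡ v
    R-sieve f v {holds} x y z root = sieve 8 1 refl 1 3 0 3 f v {holds}
      (K - + 2 * (z * z + z)) x y 0ℤ (trans (R-form K x y z) root)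

    R↔W : Sol R ↔ Sol W
    R↔W =
      rescale₁ (+ 4) (+ 0) (λ x y z root → class₄ x 0 (R-sieve (λ i _ _ → i) 0 x y z root))
      ⟫ rescale₂ (+ 2) (+ 1) (λ u y z root →
        parity-class y (R-sieve (λ _ j _ → j ℕ.% 2) 1 (+ 4 * u + + 0) y z root))

    t↔2W : Fin (t 1 3 16 n) ↔ (Sol W ⊎ Sol W)
    t↔2W = t-↔ 1 3 16 n (cong (λ i → + 8 * i + + 1 + + 3 + + 16) (pos-affine 4 k 1 n≡))
      ⟫ Sol-cong (t-form K)
      ⟫ double-x²+3y² (+ 1) g (λ x y z root →
          difference-class x y (R-sieve difference 1 x y z root))
      ⟫ (R↔W ⊎-↔ R↔W)

    2n+5≡ : + (2 ℕ.* n ℕ.+ 5) ≡ M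
    2n+5≡ = trans (pos-affine 2 n 5 refl)
      (trans (cong (λ i → + 2 * i + + 5) (pos-affine 4 k 1 n≡)) (simplify K))
      where
      simplify : ∀ k → + 2 * (+ 4 * k + + 1) + + 5 ≡ + 8 * k + + 7
      simplify = solve-∀

    N-form : ∀ M x y z →
      + 1 * ((+ 4 * z + + 2) * (+ 4 * z + + 2)) + + 3 * ((+ 2 * y + + 1) * (+ 2 * y + + 1))
      + + 16 * (x * x) - M
      ≡ + 1 * ((+ 4 * x + + 0) * (+ 4 * x + + 0) + + 3 * ((+ 2 * y + + 1) * (+ 2 * y + + 1)))
        + (+ 4 * ((+ 2 * z + + 1) * (+ 2 * z + + 1)) - M)
    N-form = solve-∀

    N↔W : Fin (N 1 3 16 (2 ℕ.* n ℕ.+ 5)) ↔ Sol W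
    N↔W = N-↔ 1 3 16 (2 ℕ.* n ℕ.+ 5) 2n+5≡
      ⟫ rescale₁ (+ 4) (+ 2) (λ x y z root →
          class₄ x 2 (sieve 8 1 refl 1 3 16 7 (λ i _ _ → i) 2 K x y z root))
      ⟫ rescale₂ (+ 2) (+ 1) (λ u y z root →
          parity-class y (sieve 8 1 refl 1 3 16 7 (λ _ j _ → j ℕ.% 2) 1 K (+ 4 * u + + 2) y z root))
      ⟫ reverse ⟫ Sol-cong (N-form M)

    2N↔2W : Fin (2 ℕ.* N 1 3 16 (2 ℕ.* n ℕ.+ 5)) ↔ (Sol W ⊎ Sol W)
    2N↔2W = double-size N↔W

    t′-form : ∀ k x y z →
      + 2 * ((+ 2 * x + + 1) * (+ 2 * x + + 1)) + + 2 * ((+ 2 * y + + 1) * (+ 2 * y + + 1))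
      + + 3 * ((+ 2 * z + + 1) * (+ 2 * z + + 1)) - (+ 8 * k + + 2 + + 2 + + 3)
      ≡ + 2 * ((+ 2 * x + + 1) * (+ 2 * x + + 1) + (+ 2 * y + + 1) * (+ 2 * y + + 1))
        + (+ 3 * ((+ 2 * z + + 1) * (+ 2 * z + + 1)) - (+ 8 * k + + 7))
    t′-form = solve-∀

    V : ℤ → ℤ → ℤ → ℤ
    V x y z = + 2 * (+ 2 * ((+ 2 * x + + 1) * (+ 2 * x + + 1) + + 4 * (y * y)))
      + (+ 3 * ((+ 2 * z + + 1) * (+ 2 * z + + 1)) - M)

    W-form : ∀ M x y z →
      + 2 * (+ 2 * ((+ 2 * z + + 1) * (+ 2 * z + + 1) + + 4 * (x * x)))
      + (+ 3 * ((+ 2 * y + + 1) * (+ 2 * y + + 1)) - M)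
      ≡ + 1 * ((+ 4 * x + + 0) * (+ 4 * x + + 0) + + 3 * ((+ 2 * y + + 1) * (+ 2 * y + + 1)))
        + (+ 4 * ((+ 2 * z + + 1) * (+ 2 * z + + 1)) - M)
    W-form = solve-∀

    V↔W : Sol V ↔ Sol W
    V↔W = rotate ⟫ Sol-cong (W-form M)

    t′↔2W : Fin (t 2 2 3 k) ↔ (Sol W ⊎ Sol W)
    t′↔2W = t-↔ 2 2 3 k refl ⟫ Sol-cong (t′-form K)
      ⟫ double-x²+y² (+ 2) (λ z → + 3 * ((+ 2 * z + + 1) * (+ 2 * z + + 1)) - M)
      ⟫ (V↔W ⊎-↔ V↔W)

  -- As before, with x and y exchanging roles: `W` holds the solutions of X² + 3(4y)² + 12Z² = 8k +
  -- 13 with X, Z odd. In the first t, 4 divides y; in N, y = 2Z and 48z² = 3(4z)²; in the last t,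
  -- 6(X² + Y²) becomes 12(Z² + 4y²).
  t[1,3,48]≡2N : ∀ {n} k → n ≡ 4 ℕ.* k →
    t 1 3 48 n ≡ 2 ℕ.* N 1 3 48 (2 ℕ.* n ℕ.+ 13) × 2 ℕ.* N 1 3 48 (2 ℕ.* n ℕ.+ 13) ≡ t 1 6 6 k
  t[1,3,48]≡2N {n} k n≡4k = size-unique t↔2W 2N↔2W , size-unique 2N↔2W t′↔2W
    where
    K = + k
    M = + 8 * + k + + 13

    n≡ : + n ≡ + 4 * K
    n≡ = trans (cong +_ n≡4k) (ℤ.pos-* 4 k)

    g : ℤ → ℤ
    g z = + 12 * ((+ 2 * z + + 1) * (+ 2 * z + + 1)) - M

    R W : ℤ → ℤ → ℤ → ℤ
    R x y z = + 1 * (x * x + + 3 * (y * y)) + g z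
    W x y z = + 1 * ((+ 2 * x + + 1) * (+ 2 * x + + 1) + + 3 * ((+ 4 * y + + 0) * (+ 4 * y + + 0))) + g z

    t-form : ∀ k x y z →
      + 1 * ((+ 2 * x + + 1) * (+ 2 * x + + 1)) + + 3 * ((+ 2 * y + + 1) * (+ 2 * y + + 1))
      + + 48 * ((+ 2 * z + + 1) * (+ 2 * z + + 1)) - (+ 8 * (+ 4 * k) + + 1 + + 3 + + 48)
      ≡ + 1 * ((+ 2 * x + + 1) * (+ 2 * x + + 1) + + 3 * ((+ 2 * y + + 1) * (+ 2 * y + + 1)))
        + + 4 * (+ 12 * ((+ 2 * z + + 1) * (+ 2 * z + + 1)) - (+ 8 * k + + 13))
    t-form = solve-∀

    R-form : ∀ k x y z →
      + 1 * (x * x) + + 3 * (y * y) + + 0 * (+ 0 * + 0) - (+ 8 * (k - + 6 * (z * z + z)) + + 1)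
      ≡ + 1 * (x * x + + 3 * (y * y)) + (+ 12 * ((+ 2 * z + + 1) * (+ 2 * z + + 1)) - (+ 8 * k + + 13))
    R-form = solve-∀

    R-sieve : ∀ f v {_ : True (sieve? 8 1 refl 1 3 0 1 f v)} x y z → R x y z ≡ 0ℤ →
      f (toℕ (residue x)) (toℕ (residue y)) 0 ≡ v
    R-sieve f v {holds} x y z root = sieve 8 1 refl 1 3 0 1 f v {holds}
      (K - + 6 * (z * z + z)) x y 0ℤ (trans (R-form K x y z) root)

    R↔W : Sol R ↔ Sol W
    R↔W =
      rescale₁ (+ 2) (+ 1) (λ x y z root → parity-class x (R-sieve (λ i _ _ → i ℕ.% 2) 1 x y z root))
      ⟫ rescale₂ (+ 4) (+ 0) (λ u y z root →
        class₄ y 0 (R-sieve (λ _ j _ → j) 0 (+ 2 * u + + 1) y z root))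

    t↔2W : Fin (t 1 3 48 n) ↔ (Sol W ⊎ Sol W)
    t↔2W = t-↔ 1 3 48 n (cong (λ i → + 8 * i + + 1 + + 3 + + 48) n≡)
      ⟫ Sol-cong (t-form K)
      ⟫ double-x²+3y² (+ 1) g (λ x y z root →
          difference-class x y (R-sieve difference 1 x y z root))
      ⟫ (R↔W ⊎-↔ R↔W)

    2n+13≡ : + (2 ℕ.* n ℕ.+ 13) ≡ M
    2n+13≡ = trans (pos-affine 2 n 13 refl)
      (trans (cong (λ i → + 2 * i + + 13) n≡) (simplify K))
      where
      simplify : ∀ k → + 2 * (+ 4 * k) + + 13 ≡ + 8 * k + + 13
      simplify = solve-∀

    N-form : ∀ M x z y →
      + 1 * ((+ 2 * x + + 1) * (+ 2 * x + + 1)) + + 3 * ((+ 4 * y + + 2) * (+ 4 * y + + 2))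
      + + 48 * (z * z) - M
      ≡ + 1 * ((+ 2 * x + + 1) * (+ 2 * x + + 1) + + 3 * ((+ 4 * z + + 0) * (+ 4 * z + + 0)))
        + (+ 12 * ((+ 2 * y + + 1) * (+ 2 * y + + 1)) - M)
    N-form = solve-∀

    N↔W : Fin (N 1 3 48 (2 ℕ.* n ℕ.+ 13)) ↔ Sol W
    N↔W = N-↔ 1 3 48 (2 ℕ.* n ℕ.+ 13) 2n+13≡
      -- The remainder 13 stays unreduced to match 8k + 13; the sieve compares modulo 8, where it is
      -- 5.
      ⟫ rescale₁ (+ 2) (+ 1) (λ x y z root →
          parity-class x (sieve 8 1 refl 1 3 48 13 (λ i _ _ → i ℕ.% 2) 1 K x y z root))
      ⟫ rescale₂ (+ 4) (+ 2) (λ u y z root →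
          class₄ y 2 (sieve 8 1 refl 1 3 48 13 (λ _ j _ → j) 2 K (+ 2 * u + + 1) y z root))
      ⟫ swap₂₃ ⟫ Sol-cong (N-form M)

    2N↔2W : Fin (2 ℕ.* N 1 3 48 (2 ℕ.* n ℕ.+ 13)) ↔ (Sol W ⊎ Sol W)
    2N↔2W = double-size N↔W

    t′-form : ∀ k y z x →
      + 1 * ((+ 2 * x + + 1) * (+ 2 * x + + 1)) + + 6 * ((+ 2 * y + + 1) * (+ 2 * y + + 1))
      + + 6 * ((+ 2 * z + + 1) * (+ 2 * z + + 1)) - (+ 8 * k + + 1 + + 6 + + 6)
      ≡ + 6 * ((+ 2 * y + + 1) * (+ 2 * y + + 1) + (+ 2 * z + + 1) * (+ 2 * z + + 1))
        + ((+ 2 * x + + 1) * (+ 2 * x + + 1) - (+ 8 * k + + 13))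
    t′-form = solve-∀

    V : ℤ → ℤ → ℤ → ℤ
    V x y z = + 6 * (+ 2 * ((+ 2 * x + + 1) * (+ 2 * x + + 1) + + 4 * (y * y)))
      + ((+ 2 * z + + 1) * (+ 2 * z + + 1) - M)

    W-form : ∀ M x y z →
      + 6 * (+ 2 * ((+ 2 * z + + 1) * (+ 2 * z + + 1) + + 4 * (y * y)))
      + ((+ 2 * x + + 1) * (+ 2 * x + + 1) - M)
      ≡ + 1 * ((+ 2 * x + + 1) * (+ 2 * x + + 1) + + 3 * ((+ 4 * y + + 0) * (+ 4 * y + + 0)))
        + (+ 12 * ((+ 2 * z + + 1) * (+ 2 * z + + 1)) - M)
    W-form = solve-∀

    V↔W : Sol V ↔ Sol W
    V↔W = reverse ⟫ Sol-cong (W-form M)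

    t′↔2W : Fin (t 1 6 6 k) ↔ (Sol W ⊎ Sol W)
    t′↔2W = t-↔ 1 6 6 k refl ⟫ rotate ⟫ Sol-cong (t′-form K)
      ⟫ double-x²+y² (+ 6) (λ z → (+ 2 * z + + 1) * (+ 2 * z + + 1) - M)
      ⟫ (V↔W ⊎-↔ V↔W)

  -- Residue classes modulo 8

  t[1,3,4]≡4/3N : ∀ n → (n ℕ.% 8 ≡ 3 ⊎ n ℕ.% 8 ≡ 5) → 3 ℕ.* t 1 3 4 n ≡ 4 ℕ.* N 1 3 4 (2 ℕ.* n ℕ.+ 2)
  t[1,3,4]≡4/3N n (inj₁ n%8≡3) = t⟨1,3,4⟩ 2 (n ℕ./ 8) {n}
    (trans (cong (λ m → 2 ℕ.* m ℕ.+ 2) (%8⇒≡ n n%8≡3)) (simplify (n ℕ./ 8)))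
    where
    simplify : ∀ j → 2 ℕ.* (3 ℕ.+ j ℕ.* 8) ℕ.+ 2 ≡ 4 ℕ.* (4 ℕ.* j ℕ.+ 2)
    simplify = ℕ-solve-∀
  t[1,3,4]≡4/3N n (inj₂ n%8≡5) = t⟨1,3,4⟩ 3 (n ℕ./ 8) {n}
    (trans (cong (λ m → 2 ℕ.* m ℕ.+ 2) (%8⇒≡ n n%8≡5)) (simplify (n ℕ./ 8)))
    where
    simplify : ∀ j → 2 ℕ.* (5 ℕ.+ j ℕ.* 8) ℕ.+ 2 ≡ 4 ℕ.* (4 ℕ.* j ℕ.+ 3)
    simplify = ℕ-solve-∀

  t[1,3,12]≡4/3N : ∀ n → (n ℕ.% 8 ≡ 0 ⊎ n ℕ.% 8 ≡ 2) → 3 ℕ.* t 1 3 12 n ≡ 4 ℕ.* N 1 3 12 (2 ℕ.* n ℕ.+ 4)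
  t[1,3,12]≡4/3N n (inj₁ n%8≡0) = t⟨1,3,12⟩ 1 (n ℕ./ 8) {n}
    (trans (cong (λ m → 2 ℕ.* m ℕ.+ 4) (%8⇒≡ n n%8≡0)) (simplify (n ℕ./ 8)))
    where
    simplify : ∀ j → 2 ℕ.* (0 ℕ.+ j ℕ.* 8) ℕ.+ 4 ≡ 4 ℕ.* (4 ℕ.* j ℕ.+ 1)
    simplify = ℕ-solve-∀
  t[1,3,12]≡4/3N n (inj₂ n%8≡2) = t⟨1,3,12⟩ 2 (n ℕ./ 8) {n}
    (trans (cong (λ m → 2 ℕ.* m ℕ.+ 4) (%8⇒≡ n n%8≡2)) (simplify (n ℕ./ 8)))
    where
    simplify : ∀ j → 2 ℕ.* (2 ℕ.+ j ℕ.* 8) ℕ.+ 4 ≡ 4 ℕ.* (4 ℕ.* j ℕ.+ 2)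
    simplify = ℕ-solve-∀

  t[1,3,36]≡4/3N : ∀ n → (n ℕ.% 8 ≡ 1 ⊎ n ℕ.% 8 ≡ 7) → 3 ℕ.* t 1 3 36 n ≡ 4 ℕ.* N 1 3 36 (2 ℕ.* n ℕ.+ 10)
  t[1,3,36]≡4/3N n (inj₁ n%8≡1) = t⟨1,3,36⟩ 3 (n ℕ./ 8) {n}
    (trans (cong (λ m → 2 ℕ.* m ℕ.+ 10) (%8⇒≡ n n%8≡1)) (simplify (n ℕ./ 8)))
    where
    simplify : ∀ j → 2 ℕ.* (1 ℕ.+ j ℕ.* 8) ℕ.+ 10 ≡ 4 ℕ.* (4 ℕ.* j ℕ.+ 3)
    simplify = ℕ-solve-∀
  -- For n = 8j + 7, 2n + 10 = 16j + 24 = 4(4(j + 1) + 2), hence the successor.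
  t[1,3,36]≡4/3N n (inj₂ n%8≡7) = t⟨1,3,36⟩ 2 (suc (n ℕ./ 8)) {n}
    (trans (cong (λ m → 2 ℕ.* m ℕ.+ 10) (%8⇒≡ n n%8≡7)) (simplify (n ℕ./ 8)))
    where
    simplify : ∀ j → 2 ℕ.* (7 ℕ.+ j ℕ.* 8) ℕ.+ 10 ≡ 4 ℕ.* (4 ℕ.* suc j ℕ.+ 2)
    simplify = ℕ-solve-∀

  t[3,4,9]≡4/3N : ∀ n → (n ℕ.% 8 ≡ 2 ⊎ n ℕ.% 8 ≡ 4) → 3 ℕ.* t 3 4 9 n ≡ 4 ℕ.* N 3 4 9 (2 ℕ.* n ℕ.+ 4)
  t[3,4,9]≡4/3N n n%8 = begin
    3 ℕ.* t 3 4 9 n                     ≡⟨ cong (3 ℕ.*_) (t-swap₂₃ 3 4 9 n) ⟩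
    3 ℕ.* t 3 9 4 n                     ≡⟨ reordered n%8 ⟩
    4 ℕ.* N 3 9 4 (2 ℕ.* n ℕ.+ 4)       ≡⟨ cong (4 ℕ.*_) (N-swap₂₃ 3 9 4 (2 ℕ.* n ℕ.+ 4)) ⟩
    4 ℕ.* N 3 4 9 (2 ℕ.* n ℕ.+ 4)       ∎
    where
    open ≡-Reasoning
    simplify₂ : ∀ j → 2 ℕ.* (2 ℕ.+ j ℕ.* 8) ℕ.+ 4 ≡ 4 ℕ.* (4 ℕ.* j ℕ.+ 2)
    simplify₂ = ℕ-solve-∀
    simplify₄ : ∀ j → 2 ℕ.* (4 ℕ.+ j ℕ.* 8) ℕ.+ 4 ≡ 4 ℕ.* (4 ℕ.* j ℕ.+ 3)
    simplify₄ = ℕ-solve-∀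
    reordered : (n ℕ.% 8 ≡ 2 ⊎ n ℕ.% 8 ≡ 4) → 3 ℕ.* t 3 9 4 n ≡ 4 ℕ.* N 3 9 4 (2 ℕ.* n ℕ.+ 4)
    reordered (inj₁ n%8≡2) = t⟨3,9,4⟩ 2 (n ℕ./ 8) {n}
      (trans (cong (λ m → 2 ℕ.* m ℕ.+ 4) (%8⇒≡ n n%8≡2)) (simplify₂ (n ℕ./ 8)))
    reordered (inj₂ n%8≡4) = t⟨3,9,4⟩ 3 (n ℕ./ 8) {n}
      (trans (cong (λ m → 2 ℕ.* m ℕ.+ 4) (%8⇒≡ n n%8≡4)) (simplify₄ (n ℕ./ 8)))

open import Data.Nat using (ℕ; suc; _+_; _*_; _%_; NonZero)
open import Data.Product using (_×_; _,_)
open import Data.Sum using (_⊎_)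
open import Relation.Binary.PropositionalEquality using (_≡_)

theorem4p1 : (n : ℕ) → .{{_ : NonZero n}} →
  ((k : ℕ) → n ≡ 4 * k + 1 →
    (t 1 3 16 n ≡ 2 * N 1 3 16 (2 * n + 5)) × (2 * N 1 3 16 (2 * n + 5) ≡ t 2 2 3 k))
  × ((k : ℕ) → n ≡ 4 * k →
    (t 1 3 48 n ≡ 2 * N 1 3 48 (2 * n + 13)) × (2 * N 1 3 48 (2 * n + 13) ≡ t 1 6 6 k))
  × ((n % 8 ≡ 3 ⊎ n % 8 ≡ 5) → 3 * t 1 3 4 n ≡ 4 * N 1 3 4 (2 * n + 2))
  × ((n % 8 ≡ 0 ⊎ n % 8 ≡ 2) → 3 * t 1 3 12 n ≡ 4 * N 1 3 12 (2 * n + 4))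
  × ((n % 8 ≡ 1 ⊎ n % 8 ≡ 7) → 3 * t 1 3 36 n ≡ 4 * N 1 3 36 (2 * n + 10))
  × ((n % 8 ≡ 2 ⊎ n % 8 ≡ 4) → 3 * t 3 4 9 n ≡ 4 * N 3 4 9 (2 * n + 4))
theorem4p1 n = t[1,3,16]≡2N , t[1,3,48]≡2N , t[1,3,4]≡4/3N n , t[1,3,12]≡4/3N n , t[1,3,36]≡4/3N n , t[3,4,9]≡4/3N n
  where open TernaryForms
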